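{- The following are equivalent. (a) There exist constants $\kappa,\rho,A,a>0$ such that for infinitely many $n$ there is an $\mathbb{F}_2$-linear code $\mathcal{C}_n\subseteq\mathbb{F}_2^n$ of dimension at least $\kappa n$ and minimum distance at least $\rho n$ that is $(A/n,a/n)$-locally testable. (b) There exist constants $\rho_0>0$, $\rho_1>1$, $A',a'>0$ such that for infinitely many $h$ there exist a Cayley graph $\mathcal{G}_h=\mathrm{Cay}(\mathbb{F}_2^h,\mathcal{D})$ and a set $\mathcal{B}^*$ of generators for $(\mathbb{F}_2^h)^*$ such that the elements of $\mathcal{B}^*$ are $(\rho_0h)$-wise independent, $|\mathcal{B}^*|\ge\rho_1h$, and $\mathcal{B}^*$ is an $(A'/h,a'/h)$-spectrum generator for $\mathcal{G}_h$.
   Context: For a linear code $\mathcal{C}\subseteq\mathbb{F}_2^n$ with dual code $\mathcal{C}^\perp$, a tester is a probability distribution $\mathcal{D}_0$ on $\mathcal{C}^\perp$. The code is $(\varepsilon,\delta)$-locally testable if it has a tester $\mathcal{D}_0$ with smoothness $\varepsilon$, i.e. $\Pr_{\alpha\leftarrow\mathcal{D}_0}[\alpha_i=1]\le\varepsilon$ for all $i\in[n]$, and soundness $\delta$, i.e. $\Pr_{\alpha\leftarrow\mathcal{D}_0}[\alpha\cdot v=1]\ge\delta\, d(v,\mathcal{C})$ for all $v\in\mathbb{F}_2^n$, where $d(v,\mathcal{C})$ is the minimum Hamming distance from $v$ to $\mathcal{C}$. $(\mathbb{F}_2^h)^*$ is the space of linear functions $b:\mathbb{F}_2^h\to\mathbb{F}_2$.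 For a probability distribution $\mathcal{D}$ on $\mathbb{F}_2^h$, $\mathrm{Cay}(\mathbb{F}_2^h,\mathcal{D})$ is the weighted graph on $\mathbb{F}_2^h$ where edge $(\alpha,\beta)$ has weight $\mathcal{D}(\alpha+\beta)$; its eigenvalues are $\lambda(b)=\mathbf{E}_{\alpha\leftarrow\mathcal{D}}[(-1)^{b(\alpha)}]$, $b\in(\mathbb{F}_2^h)^*$. A set of vectors is $d$-wise independent ($d>0$ real) if every subset of fewer than $d$ of them is linearly independent over $\mathbb{F}_2$. For a set $\mathcal{B}^*$ spanning $(\mathbb{F}_2^h)^*$, $\mathrm{rank}_{\mathcal{B}^*}(a)$ is the least number of elements of $\mathcal{B}^*$ summing to $a$. $\mathcal{B}^*$ is a $(\mu,\nu)$-spectrum generator for $\mathrm{Cay}(\mathbb{F}_2^h,\mathcal{D})$ if $\lambda(b)\ge1-\mu$ for every $b\in\mathcal{B}^*$ and $\lambda(a)\le1-\nu\cdot\mathrm{rank}_{\mathcal{B}^*}(a)$ for every $a\in(\mathbb{F}_2^h)^*$. -}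

module Defs where

open import Algebra.Apartness.Bundles using (HeytingField; HeytingCommutativeRing)
open import Algebra.Bundles using (CommutativeMonoid; CommutativeRing)
open import Algebra.Module.Bundles.Raw using (RawLeftModule)
open import Algebra.Module.Morphism.Structures using (module LeftModuleMorphisms)
open import Data.Bool using (Bool; true; false; _∧_; _xor_; if_then_else_)
open import Data.Bool.Properties using (∧-distribˡ-xor; ∧-zeroʳ; xor-∧-commutativeRing)
open import Data.Fin using (Fin)
open import Data.Fin.Subset using (Subset; ∣_∣; ⊥; _⊆_)
open import Data.Nat as ℕ using (ℕ; zero; suc; NonZero)
open import Data.Product using (Σ-syntax; ∃-syntax; _×_; _,_; proj₁)
open import Data.Sum using (_⊎_; inj₁; inj₂)
open import Data.Vec using (Vec; []; _∷_; lookup; map; replicate; zipWith; foldr′)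
open import Function.Bundles using (_⇔_; Equivalence)
open import Level using (0ℓ; _⊔_) renaming (suc to lsuc)
open import Relation.Binary using (Rel; IsStrictPartialOrder)
open import Relation.Binary.PropositionalEquality as ≡ using (_≡_; _≢_)
open import Relation.Nullary using (¬_)
open import Relation.Unary using (Pred; Decidable; _∈_; _∉_)
import Algebra.Definitions.RawMonoid as RawMonoidOps
import Algebra.Properties.Ring as RingProperties
import Algebra.Properties.CommutativeSemigroup as CommutativeSemigroupProperties
import Relation.Binary.Reasoning.Setoid as SetoidReasoning

-- A Cauchy-complete Archimedean ordered field.  The axioms are stated
-- constructively (apartness and strict order are primitive, there is no
-- trichotomy), so that Bishop's reals are a model as well as the
-- classical reals.
record RealNumbers c ℓ₁ ℓ₂ : Set (lsuc (c ⊔ ℓ₁ ⊔ ℓ₂)) where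
  field
    heytingField : HeytingField c ℓ₁ ℓ₂

  open HeytingField heytingField public hiding (zero)

  commutativeRing : CommutativeRing c ℓ₁
  commutativeRing =
    HeytingCommutativeRing.commutativeRing heytingCommutativeRing

  infix 4 _<_ _≤_

  field
    _<_                  : Rel Carrier ℓ₂
    isStrictPartialOrder : IsStrictPartialOrder _≈_ _<_
    #⇔<⊎>                : ∀ {x y} → x # y ⇔ (x < y ⊎ y < x)
    0<1                  : 0# < 1#
    +-monoˡ-<            : ∀ {x y} z → x < y → x + z < y + z
    *-positive           : ∀ {x y} → 0# < x → 0# < y → 0# < x * y

  _≤_ : Rel Carrier ℓ₂
  x ≤ y = ¬ (y < x)

  ι : ℕ → Carrier
  ι n = RawMonoidOps._×_ (CommutativeRing.+-rawMonoid commutativeRing) n 1#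

  IsCauchy : (ℕ → Carrier) → Set (c ⊔ ℓ₂)
  IsCauchy s = ∀ ε → 0# < ε →
    ∃[ N ] ∀ m n → N ℕ.≤ m → N ℕ.≤ n → s m < s n + ε

  ConvergesTo : (ℕ → Carrier) → Carrier → Set (c ⊔ ℓ₂)
  ConvergesTo s l = ∀ ε → 0# < ε →
    ∃[ N ] ∀ n → N ℕ.≤ n → s n < l + ε × l < s n + ε

  field
    archimedean : ∀ x → ∃[ n ] x < ι n
    complete    : ∀ s → IsCauchy s → ∃[ l ] ConvergesTo s l

  module < = IsStrictPartialOrder isStrictPartialOrder

  ι-< : ∀ n → ι n < ι (suc n)
  ι-< n = <.<-respˡ-≈ (+-identityˡ (ι n)) (+-monoˡ-< (ι n) 0<1)

  ι-positive : ∀ n → 0# < ι (suc n)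
  ι-positive zero    = ι-< zero
  ι-positive (suc n) = <.trans (ι-positive n) (ι-< (suc n))

  infixl 7 _/_

  _/_ : Carrier → (n : ℕ) .{{_ : NonZero n}} → Carrier
  x / suc n = x * proj₁ (#⇒invertible {ι (suc n)} {0#}
    (Equivalence.from #⇔<⊎> (inj₂ (ι-positive n))))

module _ {m ℓ} (V : RawLeftModule Bool m ℓ) where
  open RawLeftModule V

  linearCombination : ∀ {k} → (Fin k → Carrierᴹ) → Vec Bool k → Carrierᴹ
  linearCombination v c =
    RawMonoidOps.sum +ᴹ-rawMonoid (λ i → lookup c i *ₗ v i)

  LinearlyIndependent : ∀ {k} → (Fin k → Carrierᴹ) → Set ℓ
  LinearlyIndependent v =
    ∀ c → linearCombination v c ≈ᴹ 0ᴹ → c ≡ replicate _ false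

  -- A coefficient vector over 𝔽₂ is at the same time the subset of
  -- indices on which it is nonzero.
  LinearlyIndependentOn : ∀ {k} → (Fin k → Carrierᴹ) → Subset k → Set ℓ
  LinearlyIndependentOn v S =
    ∀ c → c ⊆ S → linearCombination v c ≈ᴹ 0ᴹ → c ≡ ⊥

  Spans : ∀ {k} → (Fin k → Carrierᴹ) → Set (m ⊔ ℓ)
  Spans v = ∀ x → ∃[ c ] x ≈ᴹ linearCombination v c

-- 𝔽₂ = (Bool, xor, ∧)
𝔽₂ : RawLeftModule Bool 0ℓ 0ℓ
𝔽₂ = record
  { Carrierᴹ = Bool
  ; _≈ᴹ_     = _≡_
  ; _+ᴹ_     = _xor_
  ; _*ₗ_     = _∧_
  ; 0ᴹ       = false
  ; -ᴹ_      = λ x → x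
  }

𝔽₂^_ : ℕ → RawLeftModule Bool 0ℓ 0ℓ
𝔽₂^ n = record
  { Carrierᴹ = Vec Bool n
  ; _≈ᴹ_     = _≡_
  ; _+ᴹ_     = zipWith _xor_
  ; _*ₗ_     = λ r → map (r ∧_)
  ; 0ᴹ       = replicate n false
  ; -ᴹ_      = λ x → x
  }

infixl 6 _⊕_

_⊕_ : ∀ {n} → Vec Bool n → Vec Bool n → Vec Bool n
_⊕_ {n} = RawLeftModule._+ᴹ_ (𝔽₂^ n)

infix 7 _∙_

_∙_ : ∀ {n} → Vec Bool n → Vec Bool n → Bool
u ∙ v = foldr′ _xor_ false (zipWith _∧_ u v)

hammingDistance : ∀ {n} → Vec Bool n → Vec Bool n → ℕ
hammingDistance u v = ∣ u ⊕ v ∣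

IsMinimum : ∀ {ℓ} → Pred ℕ ℓ → Pred ℕ ℓ
IsMinimum P k = P k × (∀ j → P j → k ℕ.≤ j)

module _ (h : ℕ) where
  open LeftModuleMorphisms (𝔽₂^ h) 𝔽₂ using (IsLeftModuleHomomorphism)

  record LinearFunction : Set where
    constructor linear
    field
      apply    : Vec Bool h → Bool
      isLinear : IsLeftModuleHomomorphism apply

open LinearFunction public

Dual : ℕ → RawLeftModule Bool 0ℓ 0ℓ
Dual h = record
  { Carrierᴹ = LinearFunction h
  ; _≈ᴹ_     = λ a b → ∀ α → apply a α ≡ apply b α
  ; _+ᴹ_     = λ a b → mk (λ α → apply a α xor apply b α)
                 (λ α β → ≡.trans
                   (≡.cong₂ _xor_ (homo a α β) (homo b α β))
                   (xor-interchange (apply a α) (apply a β) (apply b α) (apply b β)))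
                 (≡.cong₂ _xor_ (0-homo a) (0-homo b))
                 (λ r α → ≡.trans
                   (≡.cong₂ _xor_ (*-homo a r α) (*-homo b r α))
                   (≡.sym (∧-distribˡ-xor r (apply a α) (apply b α))))
  ; _*ₗ_     = λ r a → mk (λ α → r ∧ apply a α)
                 (λ α β → ≡.trans
                   (≡.cong (r ∧_) (homo a α β))
                   (∧-distribˡ-xor r (apply a α) (apply a β)))
                 (≡.trans (≡.cong (r ∧_) (0-homo a)) (∧-zeroʳ r))
                 (λ s α → ≡.trans
                   (≡.cong (r ∧_) (*-homo a s α))
                   (∧-exchange r s (apply a α)))
  ; 0ᴹ       = mk (λ _ → false) (λ _ _ → ≡.refl) ≡.refl
                 (λ r _ → ≡.sym (∧-zeroʳ r))
  ; -ᴹ_      = λ a → a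
  }
  where
  open LeftModuleMorphisms (𝔽₂^ h) 𝔽₂ using (module IsLeftModuleHomomorphism)

  mk : (f : Vec Bool h → Bool) →
       (∀ α β → f (α ⊕ β) ≡ f α xor f β) →
       f (replicate h false) ≡ false →
       (∀ r α → f (map (r ∧_) α) ≡ r ∧ f α) →
       LinearFunction h
  mk f +-homo 0#-homo ∧-homo = linear f record
    { +ᴹ-isGroupHomomorphism = record
      { isMonoidHomomorphism = record
        { isMagmaHomomorphism = record
          { isRelHomomorphism = record { cong = ≡.cong f }
          ; homo = +-homo
          }
        ; ε-homo = 0#-homo
        }
      ; ⁻¹-homo = λ _ → ≡.refl
      }
    ; *ₗ-homo = ∧-homo
    }

  homo : (a : LinearFunction h) → ∀ α β → apply a (α ⊕ β) ≡ apply a α xor apply a β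
  homo a = IsLeftModuleHomomorphism.+ᴹ-homo (isLinear a)

  0-homo : (a : LinearFunction h) → apply a (replicate h false) ≡ false
  0-homo a = IsLeftModuleHomomorphism.0ᴹ-homo (isLinear a)

  *-homo : (a : LinearFunction h) → ∀ r α → apply a (map (r ∧_) α) ≡ r ∧ apply a α
  *-homo a = IsLeftModuleHomomorphism.*ₗ-homo (isLinear a)

  module 𝔽 = CommutativeRing xor-∧-commutativeRing

  xor-interchange : ∀ w x y z → (w xor x) xor (y xor z) ≡ (w xor y) xor (x xor z)
  xor-interchange = CommutativeSemigroupProperties.interchange
    (CommutativeMonoid.commutativeSemigroup 𝔽.+-commutativeMonoid)

  ∧-exchange : ∀ r s x → r ∧ (s ∧ x) ≡ s ∧ (r ∧ x)
  ∧-exchange = CommutativeSemigroupProperties.x∙yz≈y∙xz 𝔽.*-commutativeSemigroup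

IsRank : ∀ {h m} → (Fin m → LinearFunction h) → LinearFunction h → Pred ℕ 0ℓ
IsRank {h} {m} B a = IsMinimum λ r → Σ[ S ∈ Subset m ]
  ∣ S ∣ ≡ r × RawLeftModule._≈ᴹ_ (Dual h) a (linearCombination (Dual h) B S)

-- Decidability of membership holds for every subset of 𝔽₂ⁿ classically.
record LinearCode (n : ℕ) : Set₁ where
  open RawLeftModule (𝔽₂^ n)
  field
    Codeword  : Pred (Vec Bool n) 0ℓ
    codeword? : Decidable Codeword
    0ᴹ-closed : 0ᴹ ∈ Codeword
    +ᴹ-closed : ∀ {x y} → x ∈ Codeword → y ∈ Codeword → x +ᴹ y ∈ Codeword
    *ₗ-closed : ∀ r {x} → x ∈ Codeword → r *ₗ x ∈ Codeword

open LinearCode public using (Codeword)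

module _ {n : ℕ} (C : LinearCode n) where

  DualCode : Pred (Vec Bool n) 0ℓ
  DualCode α = ∀ {c} → c ∈ Codeword C → α ∙ c ≡ false

  IsBasis : ∀ {k} → (Fin k → Vec Bool n) → Set
  IsBasis b = (∀ i → b i ∈ Codeword C)
            × LinearlyIndependent (𝔽₂^ n) b
            × (∀ {x} → x ∈ Codeword C → ∃[ c ] x ≡ linearCombination (𝔽₂^ n) b c)

  IsDimension : Pred ℕ 0ℓ
  IsDimension k = Σ[ b ∈ (Fin k → Vec Bool n) ] IsBasis b

  IsMinimumDistance : Pred ℕ 0ℓ
  IsMinimumDistance = IsMinimum λ d → ∃[ x ] ∃[ y ]
    x ∈ Codeword C × y ∈ Codeword C × x ≢ y × hammingDistance x y ≡ d

  IsDistanceFrom : Vec Bool n → Pred ℕ 0ℓ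
  IsDistanceFrom v = IsMinimum λ d → ∃[ c ] c ∈ Codeword C × hammingDistance v c ≡ d

-- n ranges over positive integers, so that A / n makes sense.
InfinitelyMany : ∀ {ℓ} → ((n : ℕ) .{{_ : NonZero n}} → Set ℓ) → Set ℓ
InfinitelyMany P =
  ∀ N → ∃[ n ] N ℕ.≤ n × Σ[ n≢0 ∈ NonZero n ] P n {{n≢0}}

module OverReals {c ℓ₁ ℓ₂} (ℝ : RealNumbers c ℓ₁ ℓ₂) where
  open RealNumbers ℝ public

  ∑ : ∀ {h} → (Vec Bool h → Carrier) → Carrier
  ∑ {zero}  f = f []
  ∑ {suc h} f = ∑ (λ α → f (false ∷ α)) + ∑ (λ α → f (true ∷ α))

  record Distribution (h : ℕ) : Set (c ⊔ ℓ₁ ⊔ ℓ₂) where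
    field
      mass        : Vec Bool h → Carrier
      nonNegative : ∀ α → 0# ≤ mass α
      total       : ∑ mass ≈ 1#

  open Distribution public

  𝔼 : ∀ {h} → Distribution h → (Vec Bool h → Carrier) → Carrier
  𝔼 D f = ∑ λ α → mass D α * f α

  Pr : ∀ {h} → Distribution h → (Vec Bool h → Bool) → Carrier
  Pr D event = 𝔼 D λ α → if event α then 1# else 0#

  record Tester {n : ℕ} (C : LinearCode n) : Set (c ⊔ ℓ₁ ⊔ ℓ₂) where
    field
      distribution : Distribution n
      supported    : ∀ {α} → α ∉ DualCode C → mass distribution α ≈ 0#

  open Tester public

  module _ {n : ℕ} {C : LinearCode n} (T : Tester C) where

    HasSmoothness : Carrier → Set ℓ₂
    HasSmoothness ε = ∀ i → Pr (distribution T) (λ α → lookup α i) ≤ ε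

    HasSoundness : Carrier → Set ℓ₂
    HasSoundness δ = ∀ v d → IsDistanceFrom C v d →
      δ * ι d ≤ Pr (distribution T) (λ α → α ∙ v)

  IsLocallyTestable : ∀ {n} → LinearCode n → Carrier → Carrier → Set (c ⊔ ℓ₁ ⊔ ℓ₂)
  IsLocallyTestable C ε δ =
    Σ[ T ∈ Tester C ] HasSmoothness T ε × HasSoundness T δ

  -- Cay D has the characters sign ∘ b as eigenvectors, with the eigenvalues
  -- below: see the lemma eigenvector.
  WeightedGraph : Set → Set c
  WeightedGraph V = V → V → Carrier

  Cay : ∀ {h} → Distribution h → WeightedGraph (Vec Bool h)
  Cay D α β = mass D (α ⊕ β)

  sign : Bool → Carrier
  sign x = if x then - 1# else 1#

  eigenvalue : ∀ {h} → Distribution h → LinearFunction h → Carrier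
  eigenvalue D b = 𝔼 D λ α → sign (apply b α)

  IsSpectrumGenerator : ∀ {h m} → Distribution h → (Fin m → LinearFunction h) →
                        Carrier → Carrier → Set ℓ₂
  IsSpectrumGenerator D B μ ν =
      (∀ i → 1# - μ ≤ eigenvalue D (B i))
    × (∀ a r → IsRank B a r → eigenvalue D a ≤ 1# - ν * ι r)

  IsWiseIndependent : ∀ {h m} → Carrier → (Fin m → LinearFunction h) → Set ℓ₂
  IsWiseIndependent {h} d B =
    ∀ S → ι ∣ S ∣ < d → LinearlyIndependentOn (Dual h) B S

  private
    module R = CommutativeRing commutativeRing
    open RingProperties R.ring using (-‿distribˡ-*; -‿involutive)
    open CommutativeSemigroupProperties R.*-commutativeSemigroup using (x∙yz≈xz∙y)
    open SetoidReasoning R.setoid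

    ∑-cong : ∀ {h} {f g : Vec Bool h → Carrier} → (∀ α → f α ≈ g α) → ∑ f ≈ ∑ g
    ∑-cong {zero}  f≈g = f≈g []
    ∑-cong {suc h} f≈g = +-cong (∑-cong λ α → f≈g (false ∷ α)) (∑-cong λ α → f≈g (true ∷ α))

    ∑-*ʳ : ∀ {h} (f : Vec Bool h → Carrier) x → ∑ (λ α → f α * x) ≈ ∑ f * x
    ∑-*ʳ {zero}  f x = refl
    ∑-*ʳ {suc h} f x = trans
      (+-cong (∑-*ʳ (λ α → f (false ∷ α)) x) (∑-*ʳ (λ α → f (true ∷ α)) x))
      (sym (distribʳ x _ _))

    ∑-shift : ∀ {h} (α : Vec Bool h) (f : Vec Bool h → Carrier) →
              ∑ (λ β → f (α ⊕ β)) ≈ ∑ f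
    ∑-shift []          f = refl
    ∑-shift (false ∷ α) f = +-cong (∑-shift α λ β → f (false ∷ β)) (∑-shift α λ β → f (true ∷ β))
    ∑-shift (true ∷ α)  f = trans
      (+-cong (∑-shift α λ β → f (true ∷ β)) (∑-shift α λ β → f (false ∷ β)))
      (+-comm _ _)

    ⊕-cancel : ∀ {h} (α β : Vec Bool h) → α ⊕ (α ⊕ β) ≡ β
    ⊕-cancel []          []          = ≡.refl
    ⊕-cancel (false ∷ α) (y ∷ β)     = ≡.cong (y ∷_) (⊕-cancel α β)
    ⊕-cancel (true ∷ α)  (false ∷ β) = ≡.cong (false ∷_) (⊕-cancel α β)
    ⊕-cancel (true ∷ α)  (true ∷ β)  = ≡.cong (true ∷_) (⊕-cancel α β)

    sign-xor : ∀ x y → sign (x xor y) ≈ sign x * sign y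
    sign-xor false y     = sym (*-identityˡ _)
    sign-xor true  false = sym (*-identityʳ _)
    sign-xor true  true  = begin
      1#             ≈⟨ -‿involutive 1# ⟨
      - - 1#         ≈⟨ -‿cong (*-identityˡ (- 1#)) ⟨
      - (1# * - 1#)  ≈⟨ -‿distribˡ-* 1# (- 1#) ⟩
      - 1# * - 1#    ∎

  eigenvector : ∀ {h} (D : Distribution h) (b : LinearFunction h) α →
    ∑ (λ β → Cay D α β * sign (apply b β)) ≈ eigenvalue D b * sign (apply b α)
  eigenvector {h} D b α = begin
    ∑ (λ β → mass D (α ⊕ β) * sign (apply b β))
      ≈⟨ ∑-shift α (λ β → mass D (α ⊕ β) * sign (apply b β)) ⟨
    ∑ (λ β → mass D (α ⊕ (α ⊕ β)) * sign (apply b (α ⊕ β)))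
      ≈⟨ ∑-cong term ⟩
    ∑ (λ β → (mass D β * sign (apply b β)) * sign (apply b α))
      ≈⟨ ∑-*ʳ (λ β → mass D β * sign (apply b β)) (sign (apply b α)) ⟩
    eigenvalue D b * sign (apply b α) ∎
    where
    open LeftModuleMorphisms (𝔽₂^ h) 𝔽₂ using (module IsLeftModuleHomomorphism)

    term : ∀ β → mass D (α ⊕ (α ⊕ β)) * sign (apply b (α ⊕ β))
               ≈ (mass D β * sign (apply b β)) * sign (apply b α)
    term β = begin
      mass D (α ⊕ (α ⊕ β)) * sign (apply b (α ⊕ β))
        ≡⟨ ≡.cong₂ (λ γ x → mass D γ * sign x) (⊕-cancel α β)
             (IsLeftModuleHomomorphism.+ᴹ-homo (isLinear b) α β) ⟩
      mass D β * sign (apply b α xor apply b β)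
        ≈⟨ *-congˡ (sign-xor (apply b α) (apply b β)) ⟩
      mass D β * (sign (apply b α) * sign (apply b β))
        ≈⟨ x∙yz≈xz∙y _ _ _ ⟩
      (mass D β * sign (apply b β)) * sign (apply b α) ∎

{-# OPTIONS --safe #-}

-- Let H be a parity-check matrix of C, and let B be its columns, read as linear
-- functions on 𝔽₂ʰ.  The linear dependencies among B are the codewords of C, so
-- independence is minimum distance, and the rank of Σ vᵢ bᵢ is the distance of v
-- from C.  The map α ↦ (bᵢ(α))ᵢ identifies 𝔽₂ʰ with the dual code, which turns
-- testers into distributions on 𝔽₂ʰ; since λ(b) = 1 − 2 Pr[b(α) = 1], smoothness
-- and soundness become the two conditions on a spectrum generator.
--
-- It remains to see that h and n are linearly related.  From a code, h ≥ d − 1 by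
-- the Singleton bound.  From generators, n ≤ K h by packing: cut [n] into t blocks
-- of length s; if 2t vectors are always independent, the sᵗ choices of one vector
-- per block have different sums, so sᵗ ≤ 2ʰ.
module Submission where

open import Defs
open import Algebra.Bundles using (CommutativeMonoid; CommutativeRing)
open import Algebra.Module.Bundles.Raw using (RawLeftModule)
open import Algebra.Module.Morphism.Structures using (module LeftModuleMorphisms)
open import Data.Bool using (Bool; true; false; _∧_; _xor_; if_then_else_)
import Data.Bool.Properties as Bool
open import Data.Empty using (⊥-elim)
open import Data.Fin using (Fin; zero; suc; combine; remQuot)
import Data.Fin.Properties as Fin
open import Data.Fin.Subset using (Subset; ∣_∣; ⊥; ⁅_⁆; _∈_)
open import Data.Fin.Subset.Properties using
  (∣⊥∣≡0; ∣p∣≤n; ∣⁅x⁆∣≡1; p⊆q⇒∣p∣≤∣q∣; x∈⁅x⁆; x∈⁅y⁆⇒x≡y; anySubset?)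
open import Data.Nat as ℕ using (ℕ; zero; suc; z≤n; s≤s; NonZero)
import Data.Nat.DivMod as ℕ
import Data.Nat.Properties as ℕ
open import Data.Nat.Tactic.RingSolver using (solve-∀)
open import Data.Product using (Σ-syntax; ∃-syntax; _×_; _,_; proj₁; proj₂; uncurry)
open import Data.Sum using (_⊎_; inj₁; inj₂; [_,_]′)
open import Data.Vec using (Vec; []; _∷_; _++_; head; lookup; map; padRight; tabulate)
open import Data.Vec.Properties using
  (zipWith-assoc; zipWith-comm; zipWith-identityʳ; map-id; tabulate-cong; lookup∘tabulate
  ; ∷-injectiveʳ; ++-injective; ≡-dec)
open import Function using (_∘_; id; case_of_)
open import Function.Bundles using (_⇔_; mk⇔; Equivalence)
open import Function.Definitions using (Injective)
import Relation.Binary.PropositionalEquality as ≡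
open import Relation.Binary.PropositionalEquality using (_≡_; _≢_)
open import Relation.Nullary using (¬_; Dec; yes; no; does; contradiction)
open import Relation.Nullary.Decidable using (_×-dec_; ¬?)
open import Relation.Unary using (Pred; Decidable)
import Algebra.Properties.CommutativeSemigroup as CommutativeSemigroupProperties
import Algebra.Properties.Ring as RingProperties
import Algebra.Properties.Semiring.Mult as Mult
import Relation.Binary.Reasoning.Setoid as SetoidReasoning

-- Both directions rest on `complement`, which completes an injective map out of 𝔽₂ᵏ to a split
-- exact sequence; transposing the sequence gives the dual one. For the generator map of a code, the
-- quotient is the parity-check matrix and `codim` is h. For `evaluate B`, the transposed quotient
-- generates the code and `codim` is its dimension. In both cases n = k + h is read off from
-- `dimension`.
--
-- The linear relation is needed because the parameters are multiples of 1/n on one side and of 1/h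
-- on the other: h ≤ n serves one parameter of each pair, n ≤ K h the other. A code comes with d ≥ ρ
-- n, so h ≥ d - 1 already bounds n. Generators come with independence only up to ρ₀ h and with no
-- linear upper bound on their number, which is why a counting argument is needed there.
--
-- The order on the reals is constructive: `≤` is the negation of `<`, and there is no trichotomy.
-- Case distinctions are therefore made in ℕ, with an Archimedean integer R such that ρ R > 1
-- carrying real inequalities over, and the minimum distance is found by finite search.

module LinearAlgebra where
  open ≡
  open import Data.Nat using (_≤_; _<_; _^_)

  private variable
    h k m n : ℕ

  -- Vectors over 𝔽₂ and additive maps

  infix 4 _≟_
  _≟_ : (u v : Vec Bool n) → Dec (u ≡ v)
  _≟_ = ≡-dec Bool._≟_

  ⊕-assoc : (x y z : Vec Bool n) → (x ⊕ y) ⊕ z ≡ x ⊕ (y ⊕ z)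
  ⊕-assoc = zipWith-assoc Bool.xor-assoc

  ⊕-comm : (x y : Vec Bool n) → x ⊕ y ≡ y ⊕ x
  ⊕-comm = zipWith-comm Bool.xor-comm

  ⊕-identityˡ : (x : Vec Bool n) → ⊥ ⊕ x ≡ x
  ⊕-identityˡ []      = refl
  ⊕-identityˡ (_ ∷ x) = cong (_ ∷_) (⊕-identityˡ x)

  ⊕-identityʳ : (x : Vec Bool n) → x ⊕ ⊥ ≡ x
  ⊕-identityʳ = zipWith-identityʳ Bool.xor-identityʳ

  ⊕-self : (x : Vec Bool n) → x ⊕ x ≡ ⊥
  ⊕-self []      = refl
  ⊕-self (a ∷ x) = cong₂ _∷_ (Bool.xor-same a) (⊕-self x)

  ⊕-cancelˡ : (x y : Vec Bool n) → x ⊕ (x ⊕ y) ≡ y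
  ⊕-cancelˡ x y = begin
    x ⊕ (x ⊕ y)  ≡⟨ ⊕-assoc x x y ⟨
    (x ⊕ x) ⊕ y  ≡⟨ cong (_⊕ y) (⊕-self x) ⟩
    ⊥ ⊕ y        ≡⟨ ⊕-identityˡ y ⟩
    y            ∎
    where open ≡-Reasoning

  ⊕≡⊥⇒≡ : {x y : Vec Bool n} → x ⊕ y ≡ ⊥ → x ≡ y
  ⊕≡⊥⇒≡ {x = x} {y} x⊕y≡⊥ = begin
    x            ≡⟨ ⊕-identityʳ x ⟨
    x ⊕ ⊥        ≡⟨ cong (x ⊕_) x⊕y≡⊥ ⟨
    x ⊕ (x ⊕ y)  ≡⟨ ⊕-cancelˡ x y ⟩
    y            ∎
    where open ≡-Reasoning

  infixr 8 _·_

  _·_ : Bool → Vec Bool n → Vec Bool n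
  a · x = map (a ∧_) x

  true-· : (x : Vec Bool n) → true · x ≡ x
  true-· = map-id

  false-· : (x : Vec Bool n) → false · x ≡ ⊥
  false-· []      = refl
  false-· (_ ∷ x) = cong (false ∷_) (false-· x)

  ·-distribʳ-xor : ∀ a b (x : Vec Bool n) → (a xor b) · x ≡ a · x ⊕ b · x
  ·-distribʳ-xor a b []      = refl
  ·-distribʳ-xor a b (c ∷ x) = cong₂ _∷_ (Bool.∧-distribʳ-xor c a b) (·-distribʳ-xor a b x)

  ·-distribˡ-⊕ : ∀ a (x y : Vec Bool n) → a · (x ⊕ y) ≡ a · x ⊕ a · y
  ·-distribˡ-⊕ a []      []      = refl
  ·-distribˡ-⊕ a (b ∷ x) (c ∷ y) = cong₂ _∷_ (Bool.∧-distribˡ-xor a b c) (·-distribˡ-⊕ a x y)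

  ∷-decompose : ∀ a (x : Vec Bool n) → a ∷ x ≡ a · (true ∷ ⊥) ⊕ (false ∷ x)
  ∷-decompose true  x = cong (true ∷_) (sym (trans (cong (_⊕ x) (true-· ⊥)) (⊕-identityˡ x)))
  ∷-decompose false x = cong (false ∷_) (sym (trans (cong (_⊕ x) (false-· ⊥)) (⊕-identityˡ x)))

  -- Over 𝔽₂ this is linearity, the only scalars being 0 and 1.
  Additive : (Vec Bool m → Vec Bool n) → Set
  Additive f = ∀ x y → f (x ⊕ y) ≡ f x ⊕ f y

  module _ {f : Vec Bool m → Vec Bool n} (f-additive : Additive f) where

    additive-⊥ : f ⊥ ≡ ⊥
    additive-⊥ = begin
      f ⊥                ≡⟨ ⊕-cancelˡ (f ⊥) (f ⊥) ⟨
      f ⊥ ⊕ (f ⊥ ⊕ f ⊥)  ≡⟨ cong (f ⊥ ⊕_) (f-additive ⊥ ⊥) ⟨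
      f ⊥ ⊕ f (⊥ ⊕ ⊥)    ≡⟨ cong (λ x → f ⊥ ⊕ f x) (⊕-self ⊥) ⟩
      f ⊥ ⊕ f ⊥          ≡⟨ ⊕-self (f ⊥) ⟩
      ⊥                  ∎
      where open ≡-Reasoning

    additive-· : ∀ a x → f (a · x) ≡ a · f x
    additive-· true  x = trans (cong f (true-· x)) (sym (true-· (f x)))
    additive-· false x = trans (cong f (false-· x)) (trans additive-⊥ (sym (false-· (f x))))

    additive-injective : (∀ x → f x ≡ ⊥ → x ≡ ⊥) → Injective _≡_ _≡_ f
    additive-injective kernel {x} {y} fx≡fy = ⊕≡⊥⇒≡ (kernel (x ⊕ y)
      (trans (f-additive x y) (trans (cong (_⊕ f y) fx≡fy) (⊕-self (f y)))))

  additive-∷ : {f : Vec Bool (suc m) → Vec Bool n} → Additive f →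
               ∀ a x → f (a ∷ x) ≡ a · f (true ∷ ⊥) ⊕ f (false ∷ x)
  additive-∷ {f = f} f-additive a x = begin
    f (a ∷ x)                           ≡⟨ cong f (∷-decompose a x) ⟩
    f (a · (true ∷ ⊥) ⊕ (false ∷ x))    ≡⟨ f-additive _ _ ⟩
    f (a · (true ∷ ⊥)) ⊕ f (false ∷ x)  ≡⟨ cong (_⊕ f (false ∷ x)) (additive-· f-additive a (true ∷ ⊥)) ⟩
    a · f (true ∷ ⊥) ⊕ f (false ∷ x)    ∎
    where open ≡-Reasoning

  -- The dot product and transposed maps

  ∙-comm : (u v : Vec Bool n) → u ∙ v ≡ v ∙ u
  ∙-comm []      []      = refl
  ∙-comm (a ∷ u) (b ∷ v) = cong₂ _xor_ (Bool.∧-comm a b) (∙-comm u v)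

  ∙-zeroʳ : (u : Vec Bool n) → u ∙ ⊥ ≡ false
  ∙-zeroʳ []      = refl
  ∙-zeroʳ (a ∷ u) = cong₂ _xor_ (Bool.∧-zeroʳ a) (∙-zeroʳ u)

  ∙-zeroˡ : (u : Vec Bool n) → ⊥ ∙ u ≡ false
  ∙-zeroˡ u = trans (∙-comm ⊥ u) (∙-zeroʳ u)

  xor-interchange : ∀ a b c d → (a xor b) xor (c xor d) ≡ (a xor c) xor (b xor d)
  xor-interchange = CommutativeSemigroupProperties.interchange (CommutativeMonoid.commutativeSemigroup
    (CommutativeRing.+-commutativeMonoid Bool.xor-∧-commutativeRing))

  ∙-distribˡ-⊕ : (u x y : Vec Bool n) → u ∙ (x ⊕ y) ≡ u ∙ x xor u ∙ y
  ∙-distribˡ-⊕ []      []      []      = refl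
  ∙-distribˡ-⊕ (a ∷ u) (b ∷ x) (c ∷ y) = begin
    (a ∧ (b xor c)) xor (u ∙ (x ⊕ y))            ≡⟨ cong₂ _xor_ (Bool.∧-distribˡ-xor a b c) (∙-distribˡ-⊕ u x y) ⟩
    ((a ∧ b) xor (a ∧ c)) xor (u ∙ x xor u ∙ y)  ≡⟨ xor-interchange (a ∧ b) (a ∧ c) (u ∙ x) (u ∙ y) ⟩
    ((a ∧ b) xor u ∙ x) xor ((a ∧ c) xor u ∙ y)  ∎
    where open ≡-Reasoning

  ∙-distribʳ-⊕ : (u x y : Vec Bool n) → (x ⊕ y) ∙ u ≡ x ∙ u xor y ∙ u
  ∙-distribʳ-⊕ u x y = trans (∙-comm (x ⊕ y) u)
    (trans (∙-distribˡ-⊕ u x y) (cong₂ _xor_ (∙-comm u x) (∙-comm u y)))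

  ∙-·ʳ : ∀ a (u v : Vec Bool n) → u ∙ (a · v) ≡ a ∧ u ∙ v
  ∙-·ʳ true  u v = cong (u ∙_) (true-· v)
  ∙-·ʳ false u v = trans (cong (u ∙_) (false-· v)) (∙-zeroʳ u)

  ∙-·ˡ : ∀ a (u v : Vec Bool n) → (a · u) ∙ v ≡ a ∧ u ∙ v
  ∙-·ˡ a u v = trans (∙-comm (a · u) v) (trans (∙-·ʳ a v u) (cong (a ∧_) (∙-comm v u)))

  -- Nondegeneracy of the pairing. It lets equalities of vectors be proved by pairing with a test
  -- vector and moving maps across, instead of computing coordinates.
  ∙-ext : {u v : Vec Bool n} → (∀ x → u ∙ x ≡ v ∙ x) → u ≡ v
  ∙-ext {u = []}    {[]}    _   = refl
  ∙-ext {u = a ∷ u} {b ∷ v} u≗v = cong₂ _∷_ heads (∙-ext tails)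
    where
    unit : ∀ {n} c (w : Vec Bool n) → (c ∷ w) ∙ (true ∷ ⊥) ≡ c
    unit c w = trans (cong₂ _xor_ (Bool.∧-identityʳ c) (∙-zeroʳ w)) (Bool.xor-identityʳ c)

    heads : a ≡ b
    heads = trans (sym (unit a u)) (trans (u≗v (true ∷ ⊥)) (unit b v))

    drop : ∀ {n} c (w x : Vec Bool n) → (c ∷ w) ∙ (false ∷ x) ≡ w ∙ x
    drop c w x = cong (_xor w ∙ x) (Bool.∧-zeroʳ c)

    tails : ∀ x → u ∙ x ≡ v ∙ x
    tails x = trans (sym (drop a u x)) (trans (u≗v (false ∷ x)) (drop b v x))

  ∙-zero⇒≡⊥ : {u : Vec Bool n} → (∀ x → u ∙ x ≡ false) → u ≡ ⊥
  ∙-zero⇒≡⊥ u∙≗0 = ∙-ext λ x → trans (u∙≗0 x) (sym (∙-zeroˡ x))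

  infix 10 _ᵀ

  -- The transposed matrix, `f ⁅ i ⁆` being column `i` of `f`. It is defined for every function, but
  -- is adjoint to `f` only when `f` is additive.
  _ᵀ : (Vec Bool m → Vec Bool n) → Vec Bool n → Vec Bool m
  (f ᵀ) β = tabulate λ i → β ∙ f ⁅ i ⁆

  ᵀ-∙ : {f : Vec Bool m → Vec Bool n} → Additive f → ∀ β x → (f ᵀ) β ∙ x ≡ β ∙ f x
  ᵀ-∙ {m = zero}          f-additive β []      = sym (trans (cong (β ∙_) (additive-⊥ f-additive)) (∙-zeroʳ β))
  ᵀ-∙ {m = suc m} {f = f} f-additive β (a ∷ x) = begin
    (β ∙ f (true ∷ ⊥) ∧ a) xor ((λ y → f (false ∷ y)) ᵀ) β ∙ x
      ≡⟨ cong₂ _xor_ (Bool.∧-comm _ a) (ᵀ-∙ (λ y z → f-additive (false ∷ y) (false ∷ z)) β x) ⟩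
    (a ∧ β ∙ f (true ∷ ⊥)) xor β ∙ f (false ∷ x)
      ≡⟨ cong (_xor β ∙ f (false ∷ x)) (∙-·ʳ a β (f (true ∷ ⊥))) ⟨
    (β ∙ (a · f (true ∷ ⊥))) xor β ∙ f (false ∷ x)
      ≡⟨ ∙-distribˡ-⊕ β _ _ ⟨
    β ∙ (a · f (true ∷ ⊥) ⊕ f (false ∷ x))
      ≡⟨ cong (β ∙_) (additive-∷ f-additive a x) ⟨
    β ∙ f (a ∷ x) ∎
    where open ≡-Reasoning

  ᵀ-additive : {f : Vec Bool m → Vec Bool n} → Additive f → Additive (f ᵀ)
  ᵀ-additive {f = f} f-additive α β = ∙-ext λ x → begin
    (f ᵀ) (α ⊕ β) ∙ x            ≡⟨ ᵀ-∙ f-additive (α ⊕ β) x ⟩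
    (α ⊕ β) ∙ f x                ≡⟨ ∙-distribʳ-⊕ (f x) α β ⟩
    α ∙ f x xor β ∙ f x          ≡⟨ cong₂ _xor_ (ᵀ-∙ f-additive α x) (ᵀ-∙ f-additive β x) ⟨
    (f ᵀ) α ∙ x xor (f ᵀ) β ∙ x  ≡⟨ ∙-distribʳ-⊕ x ((f ᵀ) α) ((f ᵀ) β) ⟨
    ((f ᵀ) α ⊕ (f ᵀ) β) ∙ x      ∎
    where open ≡-Reasoning

  -- Transposition reverses composition, so a section of `f` becomes a retraction of its transpose.
  ᵀ-inverse : {f : Vec Bool m → Vec Bool n} {g : Vec Bool n → Vec Bool m} →
              Additive f → Additive g → (∀ x → f (g x) ≡ x) → ∀ x → (g ᵀ) ((f ᵀ) x) ≡ x
  ᵀ-inverse {f = f} {g} f-additive g-additive fg≗id x = ∙-ext λ y → begin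
    (g ᵀ) ((f ᵀ) x) ∙ y  ≡⟨ ᵀ-∙ g-additive ((f ᵀ) x) y ⟩
    (f ᵀ) x ∙ g y        ≡⟨ ᵀ-∙ f-additive x (g y) ⟩
    x ∙ f (g y)          ≡⟨ cong (x ∙_) (fg≗id y) ⟩
    x ∙ y                ∎
    where open ≡-Reasoning

  -- Complements of injective maps

  -- A splitting of the exact sequence 0 → 𝔽₂ᵏ → 𝔽₂ⁿ → 𝔽₂^codim → 0 that starts with i.
  record Complement (i : Vec Bool k → Vec Bool n) : Set where
    field
      codim      : ℕ
      dimension  : n ≡ k ℕ.+ codim
      retract    : Vec Bool n → Vec Bool k
      quotient   : Vec Bool n → Vec Bool codim
      section    : Vec Bool codim → Vec Bool n
      quotient-additive : Additive quotient
      section-additive  : Additive section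
      quotient∘i        : ∀ x → quotient (i x) ≡ ⊥
      quotient∘section  : ∀ y → quotient (section y) ≡ y
      split             : ∀ x → i (retract x) ⊕ section (quotient x) ≡ x

    quotient≡⊥⇒i∘retract : ∀ x → quotient x ≡ ⊥ → i (retract x) ≡ x
    quotient≡⊥⇒i∘retract x qx≡⊥ = begin
      i (retract x)                         ≡⟨ ⊕-identityʳ _ ⟨
      i (retract x) ⊕ ⊥                     ≡⟨ cong (i (retract x) ⊕_) (additive-⊥ section-additive) ⟨
      i (retract x) ⊕ section ⊥             ≡⟨ cong (λ y → i (retract x) ⊕ section y) qx≡⊥ ⟨
      i (retract x) ⊕ section (quotient x)  ≡⟨ split x ⟩
      x                                     ∎
      where open ≡-Reasoning

    i∘retract∘i : ∀ x → i (retract (i x)) ≡ i x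
    i∘retract∘i x = quotient≡⊥⇒i∘retract (i x) (quotient∘i x)

    -- Exactness of the transposed sequence: when `x` is split into its two summands, a vector
    -- orthogonal to the image of `i` sees only `section (quotient x)`.
    orthogonal⇒quotientᵀ : ∀ {u} → (∀ x → u ∙ i x ≡ false) → (quotient ᵀ) ((section ᵀ) u) ≡ u
    orthogonal⇒quotientᵀ {u} u⊥i = ∙-ext λ x → begin
      (quotient ᵀ) ((section ᵀ) u) ∙ x             ≡⟨ ᵀ-∙ quotient-additive ((section ᵀ) u) x ⟩
      (section ᵀ) u ∙ quotient x                   ≡⟨ ᵀ-∙ section-additive u (quotient x) ⟩
      u ∙ section (quotient x)                     ≡⟨ cong (_xor u ∙ section (quotient x)) (u⊥i (retract x)) ⟨
      u ∙ i (retract x) xor u ∙ section (quotient x)  ≡⟨ ∙-distribˡ-⊕ u _ _ ⟨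
      u ∙ (i (retract x) ⊕ section (quotient x))   ≡⟨ cong (u ∙_) (split x) ⟩
      u ∙ x                                        ∎
      where open ≡-Reasoning

  line : Vec Bool n → Vec Bool 1 → Vec Bool n
  line w a = head a · w

  -- Gaussian elimination at the first nonzero coordinate of `w`: adding a multiple of `w` clears
  -- this pivot, and the other coordinates form the quotient. Before the pivot `w` is zero, so those
  -- coordinates pass unchanged.
  line-complement : (w : Vec Bool n) → w ≢ ⊥ → Complement (line w)
  line-complement []          w≢⊥ = ⊥-elim (w≢⊥ refl)
  line-complement (true ∷ w)  _   = record
    { codim             = _
    ; dimension         = refl
    ; retract           = λ x → head x ∷ []
    ; quotient          = λ { (a ∷ x) → x ⊕ a · w }
    ; section           = false ∷_
    ; quotient-additive = λ { (a ∷ x) (b ∷ y) → trans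
        (cong (x ⊕ y ⊕_) (·-distribʳ-xor a b w))
        (⊕-interchange x y (a · w) (b · w)) }
    ; section-additive  = λ x y → refl
    ; quotient∘i        = λ { (a ∷ []) → trans
        (cong (λ b → a · w ⊕ b · w) (Bool.∧-identityʳ a)) (⊕-self (a · w)) }
    ; quotient∘section  = λ y → trans (cong (y ⊕_) (false-· w)) (⊕-identityʳ y)
    ; split             = λ { (a ∷ x) → cong₂ _∷_
        (trans (Bool.xor-identityʳ (a ∧ true)) (Bool.∧-identityʳ a))
        (trans (cong (a · w ⊕_) (⊕-comm x (a · w))) (⊕-cancelˡ (a · w) x)) }
    }
    where
    ⊕-interchange : (w x y z : Vec Bool n) → (w ⊕ x) ⊕ (y ⊕ z) ≡ (w ⊕ y) ⊕ (x ⊕ z)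
    ⊕-interchange []      []      []      []      = refl
    ⊕-interchange (a ∷ w) (b ∷ x) (c ∷ y) (d ∷ z) = cong₂ _∷_ (xor-interchange a b c d) (⊕-interchange w x y z)
  line-complement (false ∷ w) w≢⊥ = record
    { codim             = suc C.codim
    ; dimension         = cong suc C.dimension
    ; retract           = λ { (_ ∷ x) → C.retract x }
    ; quotient          = λ { (a ∷ x) → a ∷ C.quotient x }
    ; section           = λ { (a ∷ y) → a ∷ C.section y }
    ; quotient-additive = λ { (_ ∷ x) (_ ∷ y) → cong (_ ∷_) (C.quotient-additive x y) }
    ; section-additive  = λ { (_ ∷ x) (_ ∷ y) → cong (_ ∷_) (C.section-additive x y) }
    ; quotient∘i        = λ x → cong₂ _∷_ (Bool.∧-zeroʳ (head x)) (C.quotient∘i x)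
    ; quotient∘section  = λ { (_ ∷ y) → cong (_ ∷_) (C.quotient∘section y) }
    ; split             = λ { (a ∷ x) → cong₂ _∷_
        (cong (_xor a) (Bool.∧-zeroʳ (head (C.retract x)))) (C.split x) }
    }
    where module C = Complement (line-complement w (w≢⊥ ∘ cong (false ∷_)))

  abstract
    -- Induction on `k`: first split off the image of the vectors starting with `false`, then, in
    -- the quotient, the line spanned by the image `w` of the remaining unit vector.
    complement : (i : Vec Bool k → Vec Bool n) → Additive i → (∀ x → i x ≡ ⊥ → x ≡ ⊥) → Complement i
    complement {k = zero}  i i-additive _ = record
      { codim             = _
      ; dimension         = refl
      ; retract           = λ _ → []
      ; quotient          = λ x → x
      ; section           = λ x → x
      ; quotient-additive = λ _ _ → refl
      ; section-additive  = λ _ _ → refl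
      ; quotient∘i        = λ { [] → additive-⊥ i-additive }
      ; quotient∘section  = λ _ → refl
      ; split             = λ x → trans (cong (_⊕ x) (additive-⊥ i-additive)) (⊕-identityˡ x)
      }
    complement {k = suc k} {n} i i-additive kernel = record
      { codim             = L.codim
      ; dimension         = trans C.dimension (trans (cong (k ℕ.+_) L.dimension) (ℕ.+-suc k L.codim))
      -- Since `v` is `i′ (C.retract v)` plus `C.section w`, taking out `a · v` also disturbs the
      -- part in the image of `i′`; the added multiple of `C.retract v` corrects this.
      ; retract           = λ x → coefficient x ∷ (C.retract x ⊕ coefficient x · C.retract v)
      ; quotient          = L.quotient ∘ C.quotient
      ; section           = C.section ∘ L.section
      ; quotient-additive = λ x y → trans (cong L.quotient (C.quotient-additive x y)) (L.quotient-additive _ _)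
      ; section-additive  = λ x y → trans (cong C.section (L.section-additive x y)) (C.section-additive _ _)
      ; quotient∘i        = λ { (a ∷ x) → trans (cong L.quotient (C-quotient∘i a x)) (L.quotient∘i (a ∷ [])) }
      ; quotient∘section  = λ y → trans (cong L.quotient (C.quotient∘section (L.section y))) (L.quotient∘section y)
      ; split             = split
      }
      where
      open ≡-Reasoning

      i′ : Vec Bool k → Vec Bool n
      i′ x = i (false ∷ x)

      i′-additive : Additive i′
      i′-additive x y = i-additive (false ∷ x) (false ∷ y)

      i′-kernel : ∀ x → i′ x ≡ ⊥ → x ≡ ⊥
      i′-kernel x i′x≡⊥ with refl ← kernel (false ∷ x) i′x≡⊥ = refl

      module C = Complement (complement i′ i′-additive i′-kernel)

      v : Vec Bool n
      v = i (true ∷ ⊥)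

      w : Vec Bool C.codim
      w = C.quotient v

      w≢⊥ : w ≢ ⊥
      -- If `w` vanished, `v` would also be the value of `i` at a vector starting with `false`,
      -- against injectivity.
      w≢⊥ w≡⊥ with () ← additive-injective i-additive kernel (C.quotient≡⊥⇒i∘retract v w≡⊥)

      module L = Complement (line-complement w w≢⊥)

      coefficient : Vec Bool n → Bool
      coefficient x = head (L.retract (C.quotient x))

      C-quotient∘i : ∀ a x → C.quotient (i (a ∷ x)) ≡ a · w
      C-quotient∘i a x = begin
        C.quotient (i (a ∷ x))              ≡⟨ cong C.quotient (additive-∷ i-additive a x) ⟩
        C.quotient (a · v ⊕ i′ x)           ≡⟨ C.quotient-additive _ _ ⟩
        C.quotient (a · v) ⊕ C.quotient (i′ x)
          ≡⟨ cong₂ _⊕_ (additive-· C.quotient-additive a v) (C.quotient∘i x) ⟩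
        a · w ⊕ ⊥                           ≡⟨ ⊕-identityʳ _ ⟩
        a · w                               ∎

      regroup : ∀ {n} (p q r z : Vec Bool n) → ((p ⊕ r) ⊕ (q ⊕ p)) ⊕ z ≡ q ⊕ (r ⊕ z)
      regroup p q r z = begin
        ((p ⊕ r) ⊕ (q ⊕ p)) ⊕ z  ≡⟨ cong (λ x → (x ⊕ (q ⊕ p)) ⊕ z) (⊕-comm p r) ⟩
        ((r ⊕ p) ⊕ (q ⊕ p)) ⊕ z  ≡⟨ cong (λ x → ((r ⊕ p) ⊕ x) ⊕ z) (⊕-comm q p) ⟩
        ((r ⊕ p) ⊕ (p ⊕ q)) ⊕ z  ≡⟨ cong (_⊕ z) (⊕-assoc r p (p ⊕ q)) ⟩
        (r ⊕ (p ⊕ (p ⊕ q))) ⊕ z  ≡⟨ cong (λ x → (r ⊕ x) ⊕ z) (⊕-cancelˡ p q) ⟩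
        (r ⊕ q) ⊕ z              ≡⟨ cong (_⊕ z) (⊕-comm r q) ⟩
        (q ⊕ r) ⊕ z              ≡⟨ ⊕-assoc q r z ⟩
        q ⊕ (r ⊕ z)              ∎

      split : ∀ x → i (coefficient x ∷ (C.retract x ⊕ coefficient x · C.retract v))
                  ⊕ C.section (L.section (L.quotient (C.quotient x))) ≡ x
      split x = begin
        i (a ∷ (C.retract x ⊕ a · C.retract v)) ⊕ z
          ≡⟨ cong (_⊕ z) (additive-∷ i-additive a _) ⟩
        (a · v ⊕ i′ (C.retract x ⊕ a · C.retract v)) ⊕ z
          ≡⟨ cong₂ (λ y y′ → (y ⊕ y′) ⊕ z)
               (trans (cong (a ·_) (sym (C.split v))) (·-distribˡ-⊕ a _ _))
               (trans (i′-additive _ _) (cong (i′ (C.retract x) ⊕_) (additive-· i′-additive a _))) ⟩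
        ((a · i′ (C.retract v) ⊕ a · C.section w) ⊕ (i′ (C.retract x) ⊕ a · i′ (C.retract v))) ⊕ z
          ≡⟨ regroup (a · i′ (C.retract v)) (i′ (C.retract x)) (a · C.section w) z ⟩
        i′ (C.retract x) ⊕ (a · C.section w ⊕ z)
          ≡⟨ cong (λ y → i′ (C.retract x) ⊕ (y ⊕ z)) (additive-· C.section-additive a w) ⟨
        i′ (C.retract x) ⊕ (C.section (a · w) ⊕ z)
          ≡⟨ cong (i′ (C.retract x) ⊕_) (C.section-additive _ _) ⟨
        i′ (C.retract x) ⊕ C.section (a · w ⊕ L.section (L.quotient (C.quotient x)))
          ≡⟨ cong (λ y → i′ (C.retract x) ⊕ C.section y) (L.split (C.quotient x)) ⟩
        i′ (C.retract x) ⊕ C.section (C.quotient x)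
          ≡⟨ C.split x ⟩
        x ∎
        where
        a : Bool
        a = coefficient x

        z : Vec Bool n
        z = C.section (L.section (L.quotient (C.quotient x)))

  -- Linear functions and linear combinations

  functional : Vec Bool h → LinearFunction h
  functional w = linear (_∙ w) record
    { +ᴹ-isGroupHomomorphism = record
      { isMonoidHomomorphism = record
        { isMagmaHomomorphism = record
          { isRelHomomorphism = record { cong = cong (_∙ w) }
          ; homo              = ∙-distribʳ-⊕ w
          }
        ; ε-homo = ∙-zeroˡ w
        }
      ; ⁻¹-homo = λ _ → refl
      }
    ; *ₗ-homo = λ r α → ∙-·ˡ r α w
    }

  apply-⊕ : (a : LinearFunction h) → ∀ α β → apply a (α ⊕ β) ≡ apply a α xor apply a β
  apply-⊕ a = +ᴹ-homo
    where open LeftModuleMorphisms.IsLeftModuleHomomorphism (isLinear a)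

  -- A linear function is a map into 𝔽₂¹, so its transpose at the unit vector is the vector that
  -- represents it.
  coefficients : LinearFunction h → Vec Bool h
  coefficients a = ((λ α → apply a α ∷ []) ᵀ) (true ∷ [])

  coefficients-∙ : (a : LinearFunction h) → ∀ α → α ∙ coefficients a ≡ apply a α
  coefficients-∙ a α = trans (∙-comm α (coefficients a)) (trans
    (ᵀ-∙ {f = λ α → apply a α ∷ []} (λ α β → cong (_∷ []) (apply-⊕ a α β)) (true ∷ []) α)
    (Bool.xor-identityʳ (apply a α)))

  evaluate : (Fin m → LinearFunction h) → Vec Bool h → Vec Bool m
  evaluate B α = tabulate λ i → apply (B i) α

  tabulate-⊕ : (f g : Fin n → Bool) → tabulate (λ i → f i xor g i) ≡ tabulate f ⊕ tabulate g
  tabulate-⊕ {zero}  f g = refl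
  tabulate-⊕ {suc n} f g = cong ((f zero xor g zero) ∷_) (tabulate-⊕ (f ∘ suc) (g ∘ suc))

  evaluate-additive : (B : Fin m → LinearFunction h) → Additive (evaluate B)
  evaluate-additive B α β = trans (tabulate-cong λ i → apply-⊕ (B i) α β) (tabulate-⊕ _ _)

  apply-linearCombination : (B : Fin m → LinearFunction h) → ∀ c α →
    apply (linearCombination (Dual h) B c) α ≡ c ∙ evaluate B α
  apply-linearCombination B []      α = refl
  apply-linearCombination B (a ∷ c) α =
    cong ((a ∧ apply (B zero) α) xor_) (apply-linearCombination (B ∘ suc) c α)

  linearCombination-∙ : (b : Fin k → Vec Bool n) → ∀ c w →
    linearCombination (𝔽₂^ n) b c ∙ w ≡ c ∙ tabulate (λ i → b i ∙ w)
  linearCombination-∙ b []      w = ∙-zeroˡ w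
  linearCombination-∙ {n = n} b (a ∷ c) w = trans
    (∙-distribʳ-⊕ w (a · b zero) (linearCombination (𝔽₂^ n) (b ∘ suc) c))
    (cong₂ _xor_ (∙-·ˡ a (b zero) w) (linearCombination-∙ (b ∘ suc) c w))

  linearCombination-additive : (b : Fin k → Vec Bool n) → Additive (linearCombination (𝔽₂^ n) b)
  linearCombination-additive {n = n} b c d = ∙-ext λ w → begin
    L (c ⊕ d) ∙ w
      ≡⟨ linearCombination-∙ b (c ⊕ d) w ⟩
    (c ⊕ d) ∙ tabulate (λ i → b i ∙ w)
      ≡⟨ ∙-distribʳ-⊕ _ c d ⟩
    c ∙ tabulate (λ i → b i ∙ w) xor d ∙ tabulate (λ i → b i ∙ w)
      ≡⟨ cong₂ _xor_ (linearCombination-∙ b c w) (linearCombination-∙ b d w) ⟨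
    L c ∙ w xor L d ∙ w
      ≡⟨ ∙-distribʳ-⊕ w (L c) (L d) ⟨
    (L c ⊕ L d) ∙ w ∎
    where
    open ≡-Reasoning
    L = linearCombination (𝔽₂^ n) b

  linearCombination-units : {f : Vec Bool k → Vec Bool n} → Additive f →
    ∀ c → linearCombination (𝔽₂^ n) (f ∘ ⁅_⁆) c ≡ f c
  linearCombination-units {n = n} {f = f} f-additive c = ∙-ext λ w → begin
    linearCombination (𝔽₂^ n) (f ∘ ⁅_⁆) c ∙ w
      ≡⟨ linearCombination-∙ (f ∘ ⁅_⁆) c w ⟩
    c ∙ tabulate (λ i → f ⁅ i ⁆ ∙ w)
      ≡⟨ cong (c ∙_) (tabulate-cong λ i → ∙-comm (f ⁅ i ⁆) w) ⟩
    c ∙ (f ᵀ) w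
      ≡⟨ ∙-comm c ((f ᵀ) w) ⟩
    (f ᵀ) w ∙ c
      ≡⟨ ᵀ-∙ f-additive w c ⟩
    w ∙ f c
      ≡⟨ ∙-comm w (f c) ⟩
    f c ∙ w ∎
    where open ≡-Reasoning

  linearCombination-closed : (C : LinearCode n) {b : Fin k → Vec Bool n} →
    (∀ i → Codeword C (b i)) → ∀ c → Codeword C (linearCombination (𝔽₂^ n) b c)
  linearCombination-closed C b∈C []      = LinearCode.0ᴹ-closed C
  linearCombination-closed C b∈C (a ∷ c) =
    +ᴹ-closed (*ₗ-closed a (b∈C zero)) (linearCombination-closed C (b∈C ∘ suc) c)
    where open LinearCode C

  -- A vector killed by all of `B` is killed by their span, hence by every functional.
  evaluate-injective : (B : Fin m → LinearFunction h) → Spans (Dual h) B →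
                       ∀ α → evaluate B α ≡ ⊥ → α ≡ ⊥
  evaluate-injective B spans α Bα≡⊥ = ∙-zero⇒≡⊥ λ w →
    let (c , w≗cB) = spans (functional w) in begin
      α ∙ w                                     ≡⟨ w≗cB α ⟩
      apply (linearCombination (Dual _) B c) α  ≡⟨ apply-linearCombination B c α ⟩
      c ∙ evaluate B α                          ≡⟨ cong (c ∙_) Bα≡⊥ ⟩
      c ∙ ⊥                                     ≡⟨ ∙-zeroʳ c ⟩
      false                                     ∎
    where open ≡-Reasoning

  -- Hamming weight, the Singleton bound and packing

  ∣⊕∣≤ : (x y : Vec Bool n) → ∣ x ⊕ y ∣ ≤ ∣ x ∣ ℕ.+ ∣ y ∣
  ∣⊕∣≤ []          []          = z≤n
  ∣⊕∣≤ (false ∷ x) (false ∷ y) = ∣⊕∣≤ x y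
  ∣⊕∣≤ (false ∷ x) (true ∷ y)  = ℕ.≤-trans (s≤s (∣⊕∣≤ x y)) (ℕ.≤-reflexive (sym (ℕ.+-suc ∣ x ∣ ∣ y ∣)))
  ∣⊕∣≤ (true ∷ x)  (false ∷ y) = s≤s (∣⊕∣≤ x y)
  ∣⊕∣≤ (true ∷ x)  (true ∷ y)  = ℕ.≤-trans (∣⊕∣≤ x y) (ℕ.≤-trans (ℕ.+-monoʳ-≤ ∣ x ∣ (ℕ.n≤1+n ∣ y ∣)) (ℕ.n≤1+n _))

  ∣++∣ : (x : Vec Bool m) (y : Vec Bool n) → ∣ x ++ y ∣ ≡ ∣ x ∣ ℕ.+ ∣ y ∣
  ∣++∣ []          y = refl
  ∣++∣ (false ∷ x) y = ∣++∣ x y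
  ∣++∣ (true ∷ x)  y = cong suc (∣++∣ x y)

  pad : m ≤ n → Vec Bool m → Vec Bool n
  pad m≤n = padRight m≤n false

  pad-additive : (m≤n : m ≤ n) → Additive (pad m≤n)
  pad-additive z≤n       []      []      = sym (⊕-self ⊥)
  pad-additive (s≤s m≤n) (_ ∷ x) (_ ∷ y) = cong (_ ∷_) (pad-additive m≤n x y)

  ∣pad∣ : (m≤n : m ≤ n) (x : Vec Bool m) → ∣ pad m≤n x ∣ ≡ ∣ x ∣
  ∣pad∣ {n = n} z≤n []          = ∣⊥∣≡0 n
  ∣pad∣ (s≤s m≤n)   (false ∷ x) = ∣pad∣ m≤n x
  ∣pad∣ (s≤s m≤n)   (true ∷ x)  = cong suc (∣pad∣ m≤n x)

  ∣x∣≡0⇒x≡⊥ : (x : Vec Bool n) → ∣ x ∣ ≡ 0 → x ≡ ⊥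
  ∣x∣≡0⇒x≡⊥ []          _     = refl
  ∣x∣≡0⇒x≡⊥ (false ∷ x) ∣x∣≡0 = cong (false ∷_) (∣x∣≡0⇒x≡⊥ x ∣x∣≡0)

  pad-kernel : (m≤n : m ≤ n) → ∀ x → pad m≤n x ≡ ⊥ → x ≡ ⊥
  pad-kernel {n = n} m≤n x pad≡⊥ =
    ∣x∣≡0⇒x≡⊥ x (trans (sym (∣pad∣ m≤n x)) (trans (cong ∣_∣ pad≡⊥) (∣⊥∣≡0 n)))

  module _ {f : Vec Bool n → Vec Bool h} (f-additive : Additive f) where

    -- Vectors supported on the first d - 1 coordinates have weight below `d`, so `f` is injective
    -- on them, and the complement of their image gives d - 1 ≤ h.
    singleton-bound : ∀ {d} → (∀ c → ∣ c ∣ < d → f c ≡ ⊥ → c ≡ ⊥) → d ≤ n → d ≤ suc h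
    singleton-bound {zero}  kernel d≤n   = z≤n
    singleton-bound {suc p} kernel 1+p≤n = s≤s (subst (p ≤_) (sym dimension) (ℕ.m≤m+n p codim))
      where
      p≤n = ℕ.<⇒≤ 1+p≤n
      open Complement (complement (f ∘ pad p≤n)
        (λ x y → trans (cong f (pad-additive p≤n x y)) (f-additive _ _))
        (λ x fx≡⊥ → pad-kernel p≤n x
          (kernel (pad p≤n x) (s≤s (ℕ.≤-trans (ℕ.≤-reflexive (∣pad∣ p≤n x)) (∣p∣≤n x))) fx≡⊥)))

  bit : Bool → Fin 2
  bit false = zero
  bit true  = suc zero

  encode : Vec Bool h → Fin (2 ^ h)
  encode []      = zero
  encode (a ∷ x) = combine (bit a) (encode x)

  encode-injective : Injective _≡_ _≡_ (encode {h})
  encode-injective {x = []}    {[]}    _  = refl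
  encode-injective {x = a ∷ x} {b ∷ y} eq =
    let (a≡b , x≡y) = Fin.combine-injective (bit a) (encode x) (bit b) (encode y) eq
    in cong₂ _∷_ (bit-injective a b a≡b) (encode-injective x≡y)
    where
    bit-injective : ∀ a b → bit a ≡ bit b → a ≡ b
    bit-injective false false _ = refl
    bit-injective true  true  _ = refl

  ⁅⁆-injective : {i j : Fin n} → ⁅ i ⁆ ≡ ⁅ j ⁆ → i ≡ j
  ⁅⁆-injective {i = i} {j} eq = x∈⁅y⁆⇒x≡y j (subst (i ∈_) eq (x∈⁅x⁆ i))

  -- The vectors of t blocks of length s with exactly one 1 in each block.
  blocks : ∀ s t → Fin (s ^ t) → Vec Bool (t ℕ.* s)
  blocks s zero    _ = []
  blocks s (suc t) x = ⁅ proj₁ (remQuot {s} (s ^ t) x) ⁆ ++ blocks s t (proj₂ (remQuot {s} (s ^ t) x))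

  blocks-injective : ∀ s t → Injective _≡_ _≡_ (blocks s t)
  blocks-injective s zero    {zero} {zero} _  = refl
  blocks-injective s (suc t) {x}    {y}    eq =
    let (i≡j , x′≡y′) = ++-injective ⁅ proj₁ (remQuot {s} (s ^ t) x) ⁆ ⁅ proj₁ (remQuot {s} (s ^ t) y) ⁆ eq
    in begin
      x                                       ≡⟨ Fin.combine-remQuot {s} (s ^ t) x ⟨
      uncurry combine (remQuot {s} (s ^ t) x)
        ≡⟨ cong₂ combine (⁅⁆-injective i≡j) (blocks-injective s t x′≡y′) ⟩
      uncurry combine (remQuot {s} (s ^ t) y) ≡⟨ Fin.combine-remQuot {s} (s ^ t) y ⟩
      y                                       ∎
    where open ≡-Reasoning

  ∣blocks∣ : ∀ s t x → ∣ blocks s t x ∣ ≡ t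
  ∣blocks∣ s zero    x = refl
  ∣blocks∣ s (suc t) x =
    let (i , y) = remQuot {s} (s ^ t) x
    in trans (∣++∣ ⁅ i ⁆ (blocks s t y)) (cong₂ ℕ._+_ (∣⁅x⁆∣≡1 i) (∣blocks∣ s t y))

  module _ {f : Vec Bool m → Vec Bool h} (f-additive : Additive f) where

    packing-bound : ∀ s t → (∀ c → ∣ c ∣ ≤ t ℕ.+ t → f c ≡ ⊥ → c ≡ ⊥) → t ℕ.* s ≤ m → s ^ t ≤ 2 ^ h
    packing-bound s t kernel ts≤m = Fin.injective⇒≤ {f = λ x → encode (f (word x))}
      λ {x} {y} eq → blocks-injective s t
        (additive-injective (pad-additive ts≤m) (pad-kernel ts≤m)
          (⊕≡⊥⇒≡ (kernel (word x ⊕ word y) (weight x y) (collision (encode-injective eq)))))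
      where
      word : Fin (s ^ t) → Vec Bool m
      word x = pad ts≤m (blocks s t x)

      ∣word∣ : ∀ x → ∣ word x ∣ ≡ t
      ∣word∣ x = trans (∣pad∣ ts≤m (blocks s t x)) (∣blocks∣ s t x)

      weight : ∀ x y → ∣ word x ⊕ word y ∣ ≤ t ℕ.+ t
      weight x y = ℕ.≤-trans (∣⊕∣≤ (word x) (word y)) (ℕ.≤-reflexive (cong₂ ℕ._+_ (∣word∣ x) (∣word∣ y)))

      collision : ∀ {x y} → f (word x) ≡ f (word y) → f (word x ⊕ word y) ≡ ⊥
      collision {x} {y} eq = trans (f-additive (word x) (word y))
        (trans (cong (_⊕ f (word y)) eq) (⊕-self (f (word y))))

    -- If m > 2^(4R) h, there is room for t = ⌊h / 2R⌋ blocks of length 2^(4R), so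
    -- packing gives 4Rt ≤ h, whereas h < 2R (t + 1) ≤ 4Rt.
    linear-length-bound : ∀ R .{{_ : NonZero R}} → (∀ c → ∣ c ∣ ℕ.* R ≤ h → f c ≡ ⊥ → c ≡ ⊥) →
      2 ℕ.* R ≤ h → m ≤ 2 ^ (4 ℕ.* R) ℕ.* h
    linear-length-bound R kernel 2R≤h with m ℕ.≤? 2 ^ (4 ℕ.* R) ℕ.* h
    ... | yes m≤sh = m≤sh
    ... | no  m≰sh = contradiction 1+t≤2t (ℕ.<⇒≱ 2t<1+t)
      where
      instance
        2R≢0 : NonZero (2 ℕ.* R)
        2R≢0 = ℕ.m*n≢0 2 R

      open ℕ.≤-Reasoning

      s = 2 ^ (4 ℕ.* R)
      t = h ℕ./ (2 ℕ.* R)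

      -- There is at least one block; this is what `2R ≤ h` is for.
      1+t≤2t : suc t ≤ t ℕ.+ t
      1+t≤2t = ℕ.+-monoˡ-≤ t (ℕ.m≥n⇒m/n>0 2R≤h)

      t2R≤h : t ℕ.* (2 ℕ.* R) ≤ h
      t2R≤h = ℕ.m/n*n≤m h (2 ℕ.* R)

      [2t]R≡t[2R] : ∀ t R → (t ℕ.+ t) ℕ.* R ≡ t ℕ.* (2 ℕ.* R)
      [2t]R≡t[2R] = solve-∀

      s^t≤2^h : s ^ t ≤ 2 ^ h
      s^t≤2^h = packing-bound s t
        (λ c ∣c∣≤2t → kernel c (begin
          ∣ c ∣ ℕ.* R       ≤⟨ ℕ.*-monoˡ-≤ R ∣c∣≤2t ⟩
          (t ℕ.+ t) ℕ.* R   ≡⟨ [2t]R≡t[2R] t R ⟩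
          t ℕ.* (2 ℕ.* R)   ≤⟨ t2R≤h ⟩
          h                 ∎))
        (begin
          t ℕ.* s           ≤⟨ ℕ.*-monoˡ-≤ s (ℕ.m/n≤m h (2 ℕ.* R)) ⟩
          h ℕ.* s           ≡⟨ ℕ.*-comm h s ⟩
          s ℕ.* h           <⟨ ℕ.≰⇒> m≰sh ⟩
          m                 ∎)

      regroup : ∀ t R → 2 ℕ.* R ℕ.* (t ℕ.+ t) ≡ 4 ℕ.* R ℕ.* t
      regroup = solve-∀

      4Rt≤h : 4 ℕ.* R ℕ.* t ≤ h
      4Rt≤h = ℕ.≮⇒≥ λ h<4Rt → ℕ.<⇒≱ (ℕ.^-monoʳ-< 2 (s≤s (s≤s z≤n)) h<4Rt)
        (subst (_≤ 2 ^ h) (ℕ.^-*-assoc 2 (4 ℕ.* R) t) s^t≤2^h)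

      2t<1+t : t ℕ.+ t < suc t
      2t<1+t = ℕ.*-cancelˡ-< (2 ℕ.* R) (t ℕ.+ t) (suc t) (begin-strict
        2 ℕ.* R ℕ.* (t ℕ.+ t)                     ≡⟨ regroup t R ⟩
        4 ℕ.* R ℕ.* t                             ≤⟨ 4Rt≤h ⟩
        h                                         ≡⟨ ℕ.m≡m%n+[m/n]*n h (2 ℕ.* R) ⟩
        h ℕ.% (2 ℕ.* R) ℕ.+ t ℕ.* (2 ℕ.* R)       <⟨ ℕ.+-monoˡ-< (t ℕ.* (2 ℕ.* R)) (ℕ.m%n<n h (2 ℕ.* R)) ⟩
        2 ℕ.* R ℕ.+ t ℕ.* (2 ℕ.* R)               ≡⟨ ℕ.*-comm (suc t) (2 ℕ.* R) ⟩
        2 ℕ.* R ℕ.* suc t                         ∎)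

  -- Minimum distance, and rank as distance from the code

  least : ∀ {ℓ} {P : Pred ℕ ℓ} → Decidable P → ∀ k → P k → ∃[ j ] IsMinimum P j
  least P? zero    p = 0 , p , λ _ _ → z≤n
  least P? (suc k) p with P? 0
  ... | yes p₀ = 0 , p₀ , λ _ _ → z≤n
  ... | no ¬p₀ =
    let (j , pⱼ , j-min) = least (P? ∘ suc) k p
    in suc j , pⱼ , λ { zero p₀ → contradiction p₀ ¬p₀ ; (suc i) pᵢ → s≤s (j-min i pᵢ) }

  minimum-⇔ : ∀ {ℓ ℓ′} {P : Pred ℕ ℓ} {Q : Pred ℕ ℓ′} → (∀ {j} → P j ⇔ Q j) →
              ∀ {k} → IsMinimum P k → IsMinimum Q k
  minimum-⇔ P⇔Q (p , p-min) = to p , λ j q → p-min j (from q)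
    where open module E {j} = Equivalence (P⇔Q {j})

  module _ (C : LinearCode n) where

    minimum-distance-kernel : ∀ {d} → IsMinimumDistance C d → ∀ {c} → Codeword C c → ∣ c ∣ < d → c ≡ ⊥
    minimum-distance-kernel (_ , d-min) {c} c∈C ∣c∣<d with c ≟ ⊥
    ... | yes c≡⊥ = c≡⊥
    ... | no  c≢⊥ = contradiction
      (d-min ∣ c ∣ (c , ⊥ , c∈C , LinearCode.0ᴹ-closed C , c≢⊥ , cong ∣_∣ (⊕-identityʳ c)))
      (ℕ.<⇒≱ ∣c∣<d)

    minimum-distance-≤ : ∀ {d} → IsMinimumDistance C d → d ≤ n
    minimum-distance-≤ ((x , y , _ , _ , _ , refl) , _) = ∣p∣≤n (x ⊕ y)

    -- By linearity only the weights of nonzero codewords matter, and a search over all subsets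
    -- finds the least one. The codeword is returned because the independence hypothesis will be
    -- applied to it.
    minimum-distance : ∀ c → Codeword C c → c ≢ ⊥ →
      ∃[ c′ ] Codeword C c′ × c′ ≢ ⊥ × IsMinimumDistance C ∣ c′ ∣
    minimum-distance c c∈C c≢⊥
      with least (λ d → anySubset? λ x → LinearCode.codeword? C x ×-dec ¬? (x ≟ ⊥) ×-dec (∣ x ∣ ℕ.≟ d))
                 ∣ c ∣ (c , c∈C , c≢⊥ , refl)
    ... | _ , (c′ , c′∈C , c′≢⊥ , refl) , minimal =
      c′ , c′∈C , c′≢⊥ ,
      (c′ , ⊥ , c′∈C , LinearCode.0ᴹ-closed C , c′≢⊥ , cong ∣_∣ (⊕-identityʳ c′)) ,
      λ { j (x , y , x∈C , y∈C , x≢y , ∣x⊕y∣≡j) →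
          minimal j (x ⊕ y , LinearCode.+ᴹ-closed C x∈C y∈C , x≢y ∘ ⊕≡⊥⇒≡ , ∣x⊕y∣≡j) }

  -- B is the set of columns of a parity-check matrix of C.
  ParityCheck : LinearCode m → (Fin m → LinearFunction h) → Set
  ParityCheck C B = ∀ c → Codeword C c ⇔ (∀ α → c ∙ evaluate B α ≡ false)

  module _ (C : LinearCode m) (B : Fin m → LinearFunction h) (check : ParityCheck C B)
           (a : LinearFunction h) (v : Vec Bool m) (a≗v : ∀ α → apply a α ≡ v ∙ evaluate B α) where

    -- The representations of `a` over `B` are exactly the elements of the coset of `v`: `c` and `S`
    -- determine each other by `S ≡ v ⊕ c`. Rank and distance are then minima of equivalent
    -- predicates.
    coset⇔representation : ∀ {r} →
      (∃[ c ] Codeword C c × hammingDistance v c ≡ r) ⇔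
      (Σ[ S ∈ Subset m ] ∣ S ∣ ≡ r × (∀ α → apply a α ≡ apply (linearCombination (Dual h) B S) α))
    coset⇔representation = mk⇔
      (λ { (c , c∈C , ∣v⊕c∣≡r) → v ⊕ c , ∣v⊕c∣≡r , λ α → begin
        apply a α                             ≡⟨ a≗v α ⟩
        v ∙ evaluate B α                      ≡⟨ Bool.xor-identityʳ _ ⟨
        v ∙ evaluate B α xor false            ≡⟨ cong (v ∙ evaluate B α xor_) (Equivalence.to (check c) c∈C α) ⟨
        v ∙ evaluate B α xor c ∙ evaluate B α ≡⟨ ∙-distribʳ-⊕ (evaluate B α) v c ⟨
        (v ⊕ c) ∙ evaluate B α                ≡⟨ apply-linearCombination B (v ⊕ c) α ⟨
        apply (linearCombination (Dual h) B (v ⊕ c)) α ∎ })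
      (λ { (S , ∣S∣≡r , a≗S) → v ⊕ S , Equivalence.from (check (v ⊕ S)) (λ α → begin
        (v ⊕ S) ∙ evaluate B α                ≡⟨ ∙-distribʳ-⊕ (evaluate B α) v S ⟩
        v ∙ evaluate B α xor S ∙ evaluate B α
          ≡⟨ cong₂ _xor_ (a≗v α) (trans (a≗S α) (apply-linearCombination B S α)) ⟨
        apply a α xor apply a α               ≡⟨ Bool.xor-same (apply a α) ⟩
        false                                 ∎) , trans (cong ∣_∣ (⊕-cancelˡ v S)) ∣S∣≡r })
      where open ≡-Reasoning

    distance⇒rank : ∀ {r} → IsDistanceFrom C v r → IsRank B a r
    distance⇒rank = minimum-⇔ coset⇔representation

    rank⇒distance : ∀ {r} → IsRank B a r → IsDistanceFrom C v r
    rank⇒distance = minimum-⇔ (mk⇔ (Equivalence.from coset⇔representation) (Equivalence.to coset⇔representation))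

  -- From a code to generators: the columns of a parity-check matrix

  module CodeToGenerators {n k} (C : LinearCode n) (b : Fin k → Vec Bool n) (isBasis : IsBasis C b) where

    generate : Vec Bool k → Vec Bool n
    generate = linearCombination (𝔽₂^ n) b

    open Complement (complement generate (linearCombination-additive b) (proj₁ (proj₂ isBasis))) public

    generate∈C : ∀ x → Codeword C (generate x)
    generate∈C = linearCombination-closed C (proj₁ isBasis)

    B : Fin n → LinearFunction codim
    B i = functional (quotient ⁅ i ⁆)

    -- By definition `evaluate B` is the transpose of `quotient`.
    ∙-evaluate : ∀ c α → c ∙ evaluate B α ≡ α ∙ quotient c
    ∙-evaluate c α = trans (∙-comm c (evaluate B α)) (ᵀ-∙ quotient-additive α c)

    quotient≡⊥⇒∈C : ∀ c → quotient c ≡ ⊥ → Codeword C c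
    quotient≡⊥⇒∈C c qc≡⊥ = subst (Codeword C) (quotient≡⊥⇒i∘retract c qc≡⊥) (generate∈C (retract c))

    check : ParityCheck C B
    check c = mk⇔ to from
      where
      to : Codeword C c → ∀ α → c ∙ evaluate B α ≡ false
      to c∈C α = let (x , c≡x) = proj₂ (proj₂ isBasis) c∈C in begin
        c ∙ evaluate B α           ≡⟨ ∙-evaluate c α ⟩
        α ∙ quotient c             ≡⟨ cong (λ c → α ∙ quotient c) c≡x ⟩
        α ∙ quotient (generate x)  ≡⟨ cong (α ∙_) (quotient∘i x) ⟩
        α ∙ ⊥                      ≡⟨ ∙-zeroʳ α ⟩
        false                      ∎
        where open ≡-Reasoning

      from : (∀ α → c ∙ evaluate B α ≡ false) → Codeword C c
      from c⊥B = quotient≡⊥⇒∈C c (∙-zero⇒≡⊥ λ α →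
        trans (∙-comm (quotient c) α) (trans (sym (∙-evaluate c α)) (c⊥B α)))

    -- Surjectivity of `quotient`: a preimage of the coefficient vector of `a` lists the
    -- coefficients over `B`.
    spans : Spans (Dual codim) B
    spans a = c , λ α → begin
      apply a α                                    ≡⟨ coefficients-∙ a α ⟨
      α ∙ coefficients a                           ≡⟨ cong (α ∙_) (quotient∘section (coefficients a)) ⟨
      α ∙ quotient c                               ≡⟨ ∙-evaluate c α ⟨
      c ∙ evaluate B α                             ≡⟨ apply-linearCombination B c α ⟨
      apply (linearCombination (Dual codim) B c) α ∎
      where
      open ≡-Reasoning
      c = section (coefficients a)

    retraction : ∀ α → (section ᵀ) (evaluate B α) ≡ α
    retraction = ᵀ-inverse {f = quotient} {section} quotient-additive section-additive quotient∘section

    -- Together with `retraction` and `check`, this makes `evaluate B` a bijection onto the dual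
    -- code, with inverse `section ᵀ`.
    dual⇒evaluate : ∀ {γ} → DualCode C γ → evaluate B ((section ᵀ) γ) ≡ γ
    dual⇒evaluate γ∈C⊥ = orthogonal⇒quotientᵀ λ x → γ∈C⊥ (generate∈C x)

    module _ {d} (d-min : IsMinimumDistance C d) where

      d≤1+codim : d ℕ.≤ suc codim
      d≤1+codim = singleton-bound quotient-additive
        (λ c ∣c∣<d qc≡⊥ → minimum-distance-kernel C d-min (quotient≡⊥⇒∈C c qc≡⊥) ∣c∣<d)
        (minimum-distance-≤ C d-min)

      independent : ∀ {S} → ∣ S ∣ ℕ.< d → LinearlyIndependentOn (Dual codim) B S
      independent ∣S∣<d c c⊆S cB≈0 = minimum-distance-kernel C d-min
        (Equivalence.from (check c) (λ α → trans (sym (apply-linearCombination B c α)) (cB≈0 α)))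
        (ℕ.≤-<-trans (p⊆q⇒∣p∣≤∣q∣ c⊆S) ∣S∣<d)

      -- Two equal columns at different positions would give a nonzero codeword of weight at most 2.
      distinct : 3 ℕ.≤ d → Injective _≡_ (RawLeftModule._≈ᴹ_ (Dual codim)) B
      distinct 3≤d {i} {j} Bi≈Bj = ⁅⁆-injective (⊕≡⊥⇒≡
        (minimum-distance-kernel C d-min (quotient≡⊥⇒∈C (⁅ i ⁆ ⊕ ⁅ j ⁆) quotient≡⊥)
          (ℕ.<-≤-trans (s≤s ∣i⊕j∣≤2) 3≤d)))
        where
        ∣i⊕j∣≤2 : ∣ ⁅ i ⁆ ⊕ ⁅ j ⁆ ∣ ℕ.≤ 2
        ∣i⊕j∣≤2 = ℕ.≤-trans (∣⊕∣≤ ⁅ i ⁆ ⁅ j ⁆) (ℕ.≤-reflexive (cong₂ ℕ._+_ (∣⁅x⁆∣≡1 i) (∣⁅x⁆∣≡1 j)))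

        quotient≡⊥ : quotient (⁅ i ⁆ ⊕ ⁅ j ⁆) ≡ ⊥
        quotient≡⊥ = trans (quotient-additive ⁅ i ⁆ ⁅ j ⁆) (trans
          (cong (_⊕ quotient ⁅ j ⁆) (∙-ext λ α → trans (∙-comm _ α) (trans (Bi≈Bj α) (∙-comm α _))))
          (⊕-self (quotient ⁅ j ⁆)))

  -- From generators to a code: the kernel of the syndrome

  module GeneratorsToCode {h m} (B : Fin m → LinearFunction h) (spans : Spans (Dual h) B) where

    open Complement (complement (evaluate B) (evaluate-additive B) (evaluate-injective B spans)) public

    -- The parity-check matrix itself: `syndrome c` is the vector of the function Σ cᵢ bᵢ.
    syndrome : Vec Bool m → Vec Bool h
    syndrome = evaluate B ᵀ

    syndrome-∙ : ∀ c α → syndrome c ∙ α ≡ c ∙ evaluate B α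
    syndrome-∙ = ᵀ-∙ (evaluate-additive B)

    syndrome-additive : Additive syndrome
    syndrome-additive = ᵀ-additive (evaluate-additive B)

    C : LinearCode m
    C = record
      { Codeword  = λ c → syndrome c ≡ ⊥
      ; codeword? = λ c → syndrome c ≟ ⊥
      ; 0ᴹ-closed = additive-⊥ syndrome-additive
      ; +ᴹ-closed = λ {x} {y} x∈C y∈C → trans (syndrome-additive x y) (trans (cong₂ _⊕_ x∈C y∈C) (⊕-self ⊥))
      ; *ₗ-closed = λ r {x} x∈C → trans (additive-· syndrome-additive r x)
                      (trans (cong (r ·_) x∈C) (additive-⊥ (·-distribˡ-⊕ r)))
      }

    check : ParityCheck C B
    check c = mk⇔
      (λ c∈C α → trans (sym (syndrome-∙ c α)) (trans (cong (_∙ α) c∈C) (∙-zeroˡ α)))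
      (λ c⊥B → ∙-zero⇒≡⊥ λ α → trans (syndrome-∙ c α) (c⊥B α))

    evaluate∈dual : ∀ α → DualCode C (evaluate B α)
    evaluate∈dual α {c} c∈C = trans (∙-comm (evaluate B α) c) (Equivalence.to (check c) c∈C α)

    -- The code is the annihilator of the image of `evaluate B`, that is, the image of `quotient ᵀ`.
    -- So the rows of the matrix of `quotient` form a basis.
    basis : Fin codim → Vec Bool m
    basis = quotient ᵀ ∘ ⁅_⁆

    linearCombination-basis : ∀ c → linearCombination (𝔽₂^ m) basis c ≡ (quotient ᵀ) c
    linearCombination-basis = linearCombination-units {f = quotient ᵀ} (ᵀ-additive quotient-additive)

    isBasis : IsBasis C basis
    isBasis = (λ i → basis∈C ⁅ i ⁆) , independent , λ {x} x∈C → (section ᵀ) x ,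
      sym (trans (linearCombination-basis ((section ᵀ) x)) (orthogonal⇒quotientᵀ (Equivalence.to (check x) x∈C)))
      where
      basis∈C : ∀ y → Codeword C ((quotient ᵀ) y)
      basis∈C y = Equivalence.from (check ((quotient ᵀ) y)) λ α →
        trans (ᵀ-∙ quotient-additive y (evaluate B α)) (trans (cong (y ∙_) (quotient∘i α)) (∙-zeroʳ y))

      independent : LinearlyIndependent (𝔽₂^ m) basis
      independent c cb≡⊥ = begin
        c                                ≡⟨ ᵀ-inverse {f = quotient} {section} quotient-additive section-additive quotient∘section c ⟨
        (section ᵀ) ((quotient ᵀ) c)     ≡⟨ cong (section ᵀ) (trans (sym (linearCombination-basis c)) cb≡⊥) ⟩
        (section ᵀ) ⊥                    ≡⟨ additive-⊥ {f = section ᵀ} (ᵀ-additive section-additive) ⟩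
        ⊥                                ∎
        where open ≡-Reasoning

    -- `IsMinimumDistance` asks for two distinct codewords, so the code must be shown to be
    -- nontrivial before it has a minimum distance.
    nonzero-codeword : h ℕ.< m → ∃[ c ] Codeword C c × c ≢ ⊥
    nonzero-codeword h<m = word (ℕ.+-cancelˡ-< h 0 codim (subst₂ ℕ._<_ (sym (ℕ.+-identityʳ h)) dimension h<m)) isBasis
      where
      -- `codim` is not a variable; for an arbitrary `k`, matching on `0 < k` exposes a first basis
      -- vector.
      word : ∀ {k} {b : Fin k → Vec Bool m} → 0 ℕ.< k → IsBasis C b → ∃[ c ] Codeword C c × c ≢ ⊥
      word {b = b} (s≤s _) (b∈C , independent , _) = linearCombination (𝔽₂^ m) b (true ∷ ⊥) ,
        linearCombination-closed C {b} b∈C (true ∷ ⊥) , λ e₀≡⊥ → case independent (true ∷ ⊥) e₀≡⊥ of λ ()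

    retract∘evaluate : ∀ α → retract (evaluate B α) ≡ α
    retract∘evaluate α = additive-injective (evaluate-additive B) (evaluate-injective B spans) (i∘retract∘i α)

open LinearAlgebra

-- Order and division in the constructive reals

module OrderedField {c ℓ₁ ℓ₂} (ℝ : RealNumbers c ℓ₁ ℓ₂) where
  open RealNumbers ℝ
  private
    module R = CommutativeRing commutativeRing
  open RingProperties R.ring using (-‿involutive; -0#≈0#; -‿distribˡ-*)
  open SetoidReasoning R.setoid

  private variable
    w x y z : Carrier

  <-respˡ : x ≈ y → x < z → y < z
  <-respˡ = <.<-respˡ-≈

  <-respʳ : y ≈ z → x < y → x < z
  <-respʳ = <.<-respʳ-≈

  -- Cotransitivity of apartness, where a case with the wrong direction is repaired by transitivity
  -- of `<`. It stands in for trichotomy: transitivity of `≤` and its mixed forms with `<` rest on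
  -- it.
  <-cotrans : x < y → ∀ z → x < z ⊎ z < y
  <-cotrans x<y z with #-cotrans (Equivalence.from #⇔<⊎> (inj₁ x<y)) z
  ... | inj₁ x#z = [ inj₁ , (λ z<x → inj₂ (<.trans z<x x<y)) ]′ (Equivalence.to #⇔<⊎> x#z)
  ... | inj₂ z#y = [ inj₂ , (λ y<z → inj₁ (<.trans x<y y<z)) ]′ (Equivalence.to #⇔<⊎> z#y)

  ≤-reflexive : x ≈ y → x ≤ y
  ≤-reflexive x≈y y<x = <.irrefl (sym x≈y) y<x

  ≤-trans : x ≤ y → y ≤ z → x ≤ z
  ≤-trans {y = y} x≤y y≤z z<x = [ y≤z , x≤y ]′ (<-cotrans z<x y)

  <⇒≤ : x < y → x ≤ y
  <⇒≤ = <.asym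

  ≤-<-trans : x ≤ y → y < z → x < z
  ≤-<-trans {x} x≤y y<z = [ ⊥-elim ∘ x≤y , id ]′ (<-cotrans y<z x)

  ≤-respˡ : x ≈ y → x ≤ z → y ≤ z
  ≤-respˡ x≈y = ≤-trans (≤-reflexive (sym x≈y))

  ≤-respʳ : y ≈ z → x ≤ y → x ≤ z
  ≤-respʳ y≈z x≤y = ≤-trans x≤y (≤-reflexive y≈z)

  <-≤-trans : x < y → y ≤ z → x < z
  <-≤-trans {z = z} x<y y≤z = [ id , ⊥-elim ∘ y≤z ]′ (<-cotrans x<y z)

  +-monoʳ-< : ∀ x → y < z → x + y < x + z
  +-monoʳ-< x y<z = <-respˡ (+-comm _ x) (<-respʳ (+-comm _ x) (+-monoˡ-< x y<z))

  +-mono-< : w < x → y < z → w + y < x + z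
  +-mono-< w<x y<z = <.trans (+-monoˡ-< _ w<x) (+-monoʳ-< _ y<z)

  [x+y]-y≈x : ∀ x y → (x + y) - y ≈ x
  [x+y]-y≈x x y = trans (+-assoc x y (- y)) (trans (+-congˡ (-‿inverseʳ y)) (+-identityʳ x))

  [x-y]+y≈x : ∀ x y → (x - y) + y ≈ x
  [x-y]+y≈x x y = trans (+-assoc x (- y) y) (trans (+-congˡ (-‿inverseˡ y)) (+-identityʳ x))

  +-cancelʳ-< : x + z < y + z → x < y
  +-cancelʳ-< {x} {z} {y} p = <-respˡ ([x+y]-y≈x x z) (<-respʳ ([x+y]-y≈x y z) (+-monoˡ-< (- z) p))

  +-monoˡ-≤ : ∀ z → x ≤ y → x + z ≤ y + z
  +-monoˡ-≤ z x≤y = x≤y ∘ +-cancelʳ-<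

  +-cancelʳ-≤ : x + z ≤ y + z → x ≤ y
  +-cancelʳ-≤ {z = z} p y<x = p (+-monoˡ-< z y<x)

  +-mono-≤ : w ≤ x → y ≤ z → w + y ≤ x + z
  +-mono-≤ {x = x} {y} {z} w≤x y≤z = ≤-trans (+-monoˡ-≤ y w≤x)
    (≤-respˡ (+-comm y x) (≤-respʳ (+-comm z x) (+-monoˡ-≤ x y≤z)))

  double-cancel-≤ : x + x ≤ y + y → x ≤ y
  double-cancel-≤ x+x≤y+y y<x = x+x≤y+y (+-mono-< y<x y<x)

  x<y⇒0<y-x : x < y → 0# < y - x
  x<y⇒0<y-x {x} x<y = <-respˡ (-‿inverseʳ x) (+-monoˡ-< (- x) x<y)

  0<y-x⇒x<y : 0# < y - x → x < y
  0<y-x⇒x<y {y} {x} 0<y-x = <-respˡ (+-identityˡ x) (<-respʳ ([x-y]+y≈x y x) (+-monoˡ-< x 0<y-x))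

  neg-mono-< : x < y → - y < - x
  neg-mono-< {x} {y} x<y = 0<y-x⇒x<y (<-respʳ eq (x<y⇒0<y-x x<y))
    where
    eq : y - x ≈ - x - - y
    eq = trans (+-comm y (- x)) (+-congˡ (sym (-‿involutive y)))

  neg-cancel-< : - y < - x → x < y
  neg-cancel-< {y} {x} p = <-respˡ (-‿involutive x) (<-respʳ (-‿involutive y) (neg-mono-< p))

  1-mono-≤ : x ≤ y → 1# - y ≤ 1# - x
  1-mono-≤ {x} {y} x≤y p = x≤y (neg-cancel-< (+-cancelʳ-< (<-respˡ (+-comm 1# (- x)) (<-respʳ (+-comm 1# (- y)) p))))

  1-cancel-≤ : 1# - y ≤ 1# - x → x ≤ y
  1-cancel-≤ p y<x = p (+-monoʳ-< 1# (neg-mono-< y<x))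

  *-monoˡ-< : 0# < z → x < y → x * z < y * z
  *-monoˡ-< {z} {x} {y} 0<z x<y = 0<y-x⇒x<y (<-respʳ eq (*-positive (x<y⇒0<y-x x<y) 0<z))
    where
    eq : (y - x) * z ≈ y * z - x * z
    eq = trans (distribʳ z y (- x)) (+-congˡ (sym (-‿distribˡ-* x z)))

  *-cancelʳ-≤ : 0# < z → x * z ≤ y * z → x ≤ y
  *-cancelʳ-≤ 0<z p y<x = p (*-monoˡ-< 0<z y<x)

  reciprocal : 0# < x → ∃[ y ] x * y ≈ 1#
  reciprocal {x} 0<x =
    let (y , _ , [x-0]y≈1) = #⇒invertible (Equivalence.from #⇔<⊎> (inj₂ 0<x))
    in y , trans (*-congʳ (sym (trans (+-congˡ -0#≈0#) (+-identityʳ x)))) [x-0]y≈1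

  -- Being invertible, `y` is apart from `0#`, so it remains to exclude `y < 0#`, which would give
  -- `1# < 0#`.
  reciprocal-positive : 0# < x → x * y ≈ 1# → 0# < y
  reciprocal-positive {x} {y} 0<x xy≈1 =
    [ (λ y<0 → ⊥-elim (<.asym 0<1 (<-respˡ yx≈1 (<-respʳ (zeroˡ x) (*-monoˡ-< 0<x y<0))))) , id ]′
      (Equivalence.to #⇔<⊎> (invertible⇒# (x , trans (*-congˡ y-0≈y) xy≈1 , trans (*-congʳ y-0≈y) yx≈1)))
    where
    y-0≈y : y - 0# ≈ y
    y-0≈y = trans (+-congˡ -0#≈0#) (+-identityʳ y)

    yx≈1 : y * x ≈ 1#
    yx≈1 = trans (*-comm y x) xy≈1

  -- The conclusion is strict and cannot come by contraposition as in `*-cancelʳ-≤`; multiplying by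
  -- the reciprocal produces it.
  *-cancelʳ-< : 0# < z → x * z < y * z → x < y
  *-cancelʳ-< {z} {x} {y} 0<z xz<yz =
    let (z⁻¹ , zz⁻¹≈1) = reciprocal 0<z
        eq : ∀ w → w * z * z⁻¹ ≈ w
        eq w = trans (*-assoc w z z⁻¹) (trans (*-congˡ zz⁻¹≈1) (*-identityʳ w))
    in <-respˡ (eq x) (<-respʳ (eq y) (*-monoˡ-< (reciprocal-positive 0<z zz⁻¹≈1) xz<yz))

  *-monoˡ-≤ : 0# < z → x ≤ y → x * z ≤ y * z
  *-monoˡ-≤ 0<z x≤y = x≤y ∘ *-cancelʳ-< 0<z

  *-monoʳ-≤ : 0# < z → x ≤ y → z * x ≤ z * y
  *-monoʳ-≤ {z} {x} {y} 0<z x≤y = ≤-respˡ (*-comm x z) (≤-respʳ (*-comm y z) (*-monoˡ-≤ 0<z x≤y))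

  open Mult R.semiring using (×1-homo-*; ×-homo-+)

  ι-homo-+ : ∀ m n → ι (m ℕ.+ n) ≈ ι m + ι n
  ι-homo-+ = ×-homo-+ 1#

  ι-homo-* : ∀ m n → ι (m ℕ.* n) ≈ ι m * ι n
  ι-homo-* = ×1-homo-*

  0<ι : ∀ n .{{_ : NonZero n}} → 0# < ι n
  0<ι (suc n) = ι-positive n

  ι-mono-< : ∀ {m n} → m ℕ.< n → ι m < ι n
  ι-mono-< {m} {suc n} (s≤s m≤n) with ℕ.m≤n⇒m<n∨m≡n m≤n
  ... | inj₁ m<n    = <.trans (ι-mono-< m<n) (ι-< n)
  ... | inj₂ ≡.refl = ι-< n

  ι-cancel-≤ : ∀ {m n} → ι m ≤ ι n → m ℕ.≤ n
  ι-cancel-≤ ιm≤ιn = ℕ.≮⇒≥ (ιm≤ιn ∘ ι-mono-<)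

  ι-cancel-< : ∀ {m n} → ι m < ι n → m ℕ.< n
  ι-cancel-< ιm<ιn = ℕ.≰⇒> λ n≤m →
    [ (λ n<m → <.asym (ι-mono-< n<m) ιm<ιn)
    , (λ { ≡.refl → <.irrefl refl ιm<ιn })
    ]′ (ℕ.m≤n⇒m<n∨m≡n n≤m)

  ι-mono-≤ : ∀ {m n} → m ℕ.≤ n → ι m ≤ ι n
  ι-mono-≤ m≤n ιn<ιm = ℕ.<⇒≱ (ι-cancel-< ιn<ιm) m≤n

  -- `*-monoˡ-≤` needs a positive factor, whereas ranks and distances may be 0; for a natural number
  -- the two cases can be told apart.
  *ι-mono-≤ : ∀ n → x ≤ y → x * ι n ≤ y * ι n
  *ι-mono-≤ zero    x≤y = ≤-reflexive (trans (zeroʳ _) (sym (zeroʳ _)))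
  *ι-mono-≤ (suc n) x≤y = *-monoˡ-≤ (ι-positive n) x≤y

  /-*ι : ∀ x n .{{_ : NonZero n}} → (x / n) * ι n ≈ x
  /-*ι x (suc n) = begin
    (x * n⁻¹) * ι (suc n)         ≈⟨ *-assoc x _ _ ⟩
    x * (n⁻¹ * ι (suc n))         ≈⟨ *-congˡ (*-congˡ (trans (+-congˡ -0#≈0#) (+-identityʳ _))) ⟨
    x * (n⁻¹ * (ι (suc n) - 0#))  ≈⟨ *-congˡ (proj₁ (proj₂ invertible)) ⟩
    x * 1#                        ≈⟨ *-identityʳ x ⟩
    x                             ∎
    where
    invertible = #⇒invertible {ι (suc n)} {0#} (Equivalence.from #⇔<⊎> (inj₂ (ι-positive n)))
    n⁻¹ = proj₁ invertible

  /-positive : ∀ n .{{_ : NonZero n}} → 0# < x → 0# < x / n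
  /-positive {x} n 0<x = *-cancelʳ-< (0<ι n) (<-respˡ (sym (zeroˡ _)) (<-respʳ (sym (/-*ι x n)) 0<x))

  /-distrib-+ : ∀ x y n .{{_ : NonZero n}} → (x + y) / n ≈ x / n + y / n
  /-distrib-+ x y (suc n) = distribʳ _ x y

  /-congˡ : ∀ n .{{_ : NonZero n}} → x ≈ y → x / n ≈ y / n
  /-congˡ (suc n) = *-congʳ

  half+half : ∀ x → x / 2 + x / 2 ≈ x
  half+half x = begin
    x / 2 + x / 2             ≈⟨ +-cong (*-identityʳ _) (*-identityʳ _) ⟨
    x / 2 * 1# + x / 2 * 1#   ≈⟨ distribˡ (x / 2) 1# 1# ⟨
    x / 2 * (1# + 1#)         ≈⟨ *-congˡ (+-congˡ (+-identityʳ 1#)) ⟨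
    x / 2 * ι 2               ≈⟨ /-*ι x 2 ⟩
    x                         ∎

  -- Multiplied by `ι n`, the claim reads `y * ι n ≤ y * ι p`. In this form constants over h and
  -- over n are compared.
  ≤-/ : ∀ {n p} .{{_ : NonZero n}} → 0# < y → y * ι p ≈ x → n ℕ.≤ p → y ≤ x / n
  ≤-/ {y} {x} {n} {p} 0<y yp≈x n≤p = *-cancelʳ-≤ (0<ι n)
    (≤-respʳ (trans yp≈x (sym (/-*ι x n))) (*-monoʳ-≤ 0<y (ι-mono-≤ n≤p)))

  /-antimono : ∀ {m n} .{{_ : NonZero m}} .{{_ : NonZero n}} → 0# < x → m ℕ.≤ n → x / n ≤ x / m
  /-antimono {x} {m} {n} 0<x m≤n = ≤-/ (/-positive n 0<x) (/-*ι x n) m≤n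

  archimedean-* : 0# < x → ∃[ n ] NonZero n × 1# < x * ι n
  archimedean-* {x} 0<x =
    let (x⁻¹ , xx⁻¹≈1) = reciprocal 0<x
        (n , x⁻¹<n)    = archimedean x⁻¹
        0<n            = ι-cancel-< {0} {n} (<.trans (reciprocal-positive 0<x xx⁻¹≈1) x⁻¹<n)
    in n , ℕ.>-nonZero 0<n ,
       <-respˡ xx⁻¹≈1 (<-respˡ (*-comm x⁻¹ x) (<-respʳ (*-comm (ι n) x) (*-monoˡ-< 0<x x⁻¹<n)))

-- Sums over the cube, probabilities and eigenvalues

module Sums {c ℓ₁ ℓ₂} (ℝ : RealNumbers c ℓ₁ ℓ₂) where
  open OverReals ℝ
  open OrderedField ℝ
  private
    module R = CommutativeRing commutativeRing
  open CommutativeSemigroupProperties R.+-commutativeSemigroup using (interchange)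
  open SetoidReasoning R.setoid

  private variable
    h m n : ℕ

  _when_ : ∀ {p} {P : Set p} → Carrier → Dec P → Carrier
  x when P? = if does P? then x else 0#

  when-true : ∀ {p} {P : Set p} {x} (P? : Dec P) → P → x when P? ≈ x
  when-true (yes _) _ = refl
  when-true (no ¬p) p = contradiction p ¬p

  when-false : ∀ {p} {P : Set p} {x} (P? : Dec P) → ¬ P → x when P? ≈ 0#
  when-false (yes p) ¬p = contradiction p ¬p
  when-false (no _)  _  = refl

  when-nonNegative : ∀ {p} {P : Set p} {x} (P? : Dec P) → 0# ≤ x → 0# ≤ x when P?
  when-nonNegative (yes _) 0≤x = 0≤x
  when-nonNegative (no _)  _   = ≤-reflexive refl

  ∑-cong : {f g : Vec Bool h → Carrier} → (∀ α → f α ≈ g α) → ∑ f ≈ ∑ g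
  ∑-cong {zero}  f≈g = f≈g []
  ∑-cong {suc h} f≈g = +-cong (∑-cong (f≈g ∘ (false ∷_))) (∑-cong (f≈g ∘ (true ∷_)))

  ∑-zero : {f : Vec Bool h → Carrier} → (∀ α → f α ≈ 0#) → ∑ f ≈ 0#
  ∑-zero {zero}  f≈0 = f≈0 []
  ∑-zero {suc h} f≈0 = trans (+-cong (∑-zero (f≈0 ∘ (false ∷_))) (∑-zero (f≈0 ∘ (true ∷_)))) (+-identityˡ 0#)

  ∑-+ : (f g : Vec Bool h → Carrier) → ∑ (λ α → f α + g α) ≈ ∑ f + ∑ g
  ∑-+ {zero}  f g = refl
  ∑-+ {suc h} f g = trans
    (+-cong (∑-+ (f ∘ (false ∷_)) (g ∘ (false ∷_))) (∑-+ (f ∘ (true ∷_)) (g ∘ (true ∷_))))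
    (interchange _ _ _ _)

  ∑-swap : (F : Vec Bool m → Vec Bool n → Carrier) →
           ∑ (λ α → ∑ (F α)) ≈ ∑ (λ β → ∑ (λ α → F α β))
  ∑-swap {zero}  F = refl
  ∑-swap {suc m} F = trans
    (+-cong (∑-swap (F ∘ (false ∷_))) (∑-swap (F ∘ (true ∷_))))
    (sym (∑-+ (λ β → ∑ λ α → F (false ∷ α) β) (λ β → ∑ λ α → F (true ∷ α) β)))

  ∑-point : (f : Vec Bool h → Carrier) → ∀ x → (∀ α → α ≢ x → f α ≈ 0#) → ∑ f ≈ f x
  ∑-point f []          _   = refl
  ∑-point f (false ∷ x) f≈0 = trans
    (+-cong (∑-point (f ∘ (false ∷_)) x (λ α α≢x → f≈0 _ (α≢x ∘ ∷-injectiveʳ)))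
            (∑-zero (λ α → f≈0 (true ∷ α) λ ())))
    (+-identityʳ _)
  ∑-point f (true ∷ x)  f≈0 = trans
    (+-cong (∑-zero (λ α → f≈0 (false ∷ α) λ ()))
            (∑-point (f ∘ (true ∷_)) x (λ α α≢x → f≈0 _ (α≢x ∘ ∷-injectiveʳ))))
    (+-identityˡ _)

  -- Double counting of the pairs with `H β ≡ γ`: the left inverse leaves `L γ` as the only
  -- candidate for `β`, and where it fails `f γ` vanishes.
  ∑-reindex : (H : Vec Bool h → Vec Bool n) (L : Vec Bool n → Vec Bool h) →
    (∀ β → L (H β) ≡ β) → (f : Vec Bool n → Carrier) → (∀ γ → H (L γ) ≢ γ → f γ ≈ 0#) →
    ∑ (λ β → f (H β)) ≈ ∑ f
  ∑-reindex H L LH≗id f f≈0 = begin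
    ∑ (λ β → f (H β))              ≈⟨ ∑-cong row ⟨
    ∑ (λ β → ∑ (F β))              ≈⟨ ∑-swap F ⟩
    ∑ (λ γ → ∑ (λ β → F β γ))      ≈⟨ ∑-cong column ⟩
    ∑ f                            ∎
    where
    F : Vec Bool _ → Vec Bool _ → Carrier
    F β γ = f γ when (H β ≟ γ)

    row : ∀ β → ∑ (F β) ≈ f (H β)
    row β = trans (∑-point (F β) (H β) (λ γ γ≢Hβ → when-false (H β ≟ γ) (γ≢Hβ ∘ ≡.sym)))
      (when-true (H β ≟ H β) ≡.refl)

    column : ∀ γ → ∑ (λ β → F β γ) ≈ f γ
    column γ = trans
      (∑-point (λ β → F β γ) (L γ) (λ β β≢Lγ → when-false (H β ≟ γ)
        λ Hβ≡γ → β≢Lγ (≡.trans (≡.sym (LH≗id β)) (≡.cong L Hβ≡γ))))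
      diagonal
      where
      diagonal : F (L γ) γ ≈ f γ
      diagonal with H (L γ) ≟ γ
      ... | yes _    = refl
      ... | no HLγ≢γ = sym (f≈0 γ HLγ≢γ)

  Pr-cong : (D : Distribution h) {e e′ : Vec Bool h → Bool} → (∀ α → e α ≡ e′ α) → Pr D e ≈ Pr D e′
  Pr-cong D e≗e′ = ∑-cong λ α → reflexive (≡.cong (λ x → mass D α * (if x then 1# else 0#)) (e≗e′ α))

  Pr-reindex : (H : Vec Bool h → Vec Bool n) (L : Vec Bool n → Vec Bool h) → (∀ β → L (H β) ≡ β) →
    (D : Distribution h) (D₀ : Distribution n) → (∀ β → mass D β ≈ mass D₀ (H β)) →
    (∀ γ → H (L γ) ≢ γ → mass D₀ γ ≈ 0#) →
    (e : Vec Bool n → Bool) → Pr D (e ∘ H) ≈ Pr D₀ e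
  Pr-reindex H L LH≗id D D₀ mass≈ mass≈0 e = trans
    (∑-cong λ β → *-congʳ (mass≈ β))
    (∑-reindex H L LH≗id (λ γ → mass D₀ γ * (if e γ then 1# else 0#))
      λ γ HLγ≢γ → trans (*-congʳ (mass≈0 γ HLγ≢γ)) (zeroˡ _))

  -- Pointwise, the sign plus twice the indicator is `1#`; the subtraction is made once, after
  -- summing.
  𝔼-sign : (D : Distribution h) (e : Vec Bool h → Bool) →
           𝔼 D (sign ∘ e) ≈ 1# - (Pr D e + Pr D e)
  𝔼-sign D e = begin
    E                        ≈⟨ [x+y]-y≈x E (P + P) ⟨
    (E + (P + P)) - (P + P)  ≈⟨ +-congʳ sum≈1 ⟩
    1# - (P + P)             ∎
    where
    s p : Vec Bool _ → Carrier
    s α = mass D α * sign (e α)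
    p α = mass D α * (if e α then 1# else 0#)

    E = ∑ s
    P = ∑ p

    pointwise : ∀ x b → x * sign b + (x * (if b then 1# else 0#) + x * (if b then 1# else 0#)) ≈ x
    pointwise x false = trans (+-cong (*-identityʳ x) (trans (+-cong (zeroʳ x) (zeroʳ x)) (+-identityˡ 0#))) (+-identityʳ x)
    pointwise x true  = begin
      x * - 1# + (x * 1# + x * 1#)  ≈⟨ +-assoc _ _ _ ⟨
      (x * - 1# + x * 1#) + x * 1#  ≈⟨ +-congʳ (distribˡ x (- 1#) 1#) ⟨
      x * (- 1# + 1#) + x * 1#      ≈⟨ +-cong (trans (*-congˡ (-‿inverseˡ 1#)) (zeroʳ x)) (*-identityʳ x) ⟩
      0# + x                        ≈⟨ +-identityˡ x ⟩
      x                             ∎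

    sum≈1 : E + (P + P) ≈ 1#
    sum≈1 = begin
      E + (P + P)                    ≈⟨ +-congˡ (∑-+ p p) ⟨
      E + ∑ (λ α → p α + p α)        ≈⟨ ∑-+ s (λ α → p α + p α) ⟨
      ∑ (λ α → s α + (p α + p α))    ≈⟨ ∑-cong (λ α → pointwise (mass D α) (e α)) ⟩
      ∑ (mass D)                     ≈⟨ total D ⟩
      1#                             ∎

  module _ (D : Distribution h) (D₀ : Distribution m) (B : Fin m → LinearFunction h)
           (transfer : ∀ e → Pr D (e ∘ evaluate B) ≈ Pr D₀ e) where

    eigenvalue-transfer : ∀ a e → (∀ α → apply a α ≡ e (evaluate B α)) →
      eigenvalue D a ≈ 1# - (Pr D₀ e + Pr D₀ e)
    eigenvalue-transfer a e a≗e = trans (𝔼-sign D (apply a)) (+-congˡ (-‿cong (+-cong P≈ P≈)))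
      where
      P≈ : Pr D (apply a) ≈ Pr D₀ e
      P≈ = trans (Pr-cong D a≗e) (transfer e)

    eigenvalue-generator : ∀ i → let P = Pr D₀ (λ γ → lookup γ i) in
      eigenvalue D (B i) ≈ 1# - (P + P)
    eigenvalue-generator i = eigenvalue-transfer (B i) (λ γ → lookup γ i)
      λ α → ≡.sym (lookup∘tabulate (λ i → apply (B i) α) i)

    eigenvalue-combination : ∀ a v → (∀ α → apply a α ≡ v ∙ evaluate B α) →
      let P = Pr D₀ (λ γ → γ ∙ v) in eigenvalue D a ≈ 1# - (P + P)
    eigenvalue-combination a v a≗v = eigenvalue-transfer a (λ γ → γ ∙ v)
      λ α → ≡.trans (a≗v α) (∙-comm v (evaluate B α))

-- Testers and distributions on 𝔽₂ʰ

module Transfer {c ℓ₁ ℓ₂} (ℝ : RealNumbers c ℓ₁ ℓ₂) where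
  open OverReals ℝ
  open OrderedField ℝ
  open Sums ℝ

  module _ {n k} (C : LinearCode n) (b : Fin k → Vec Bool n) (isBasis : IsBasis C b) (T : Tester C) where
    open CodeToGenerators C b isBasis

    -- Pullback along `evaluate B` loses no mass, because the tester vanishes off the dual code, all
    -- of which is in the image.
    restriction : Distribution codim
    restriction = record
      { mass        = mass D₀ ∘ evaluate B
      ; nonNegative = nonNegative D₀ ∘ evaluate B
      ; total       = trans (∑-reindex (evaluate B) (section ᵀ) retraction (mass D₀) vanishes) (total D₀)
      }
      where
      D₀ = distribution T

      vanishes : ∀ γ → evaluate B ((section ᵀ) γ) ≢ γ → mass D₀ γ ≈ 0#
      vanishes γ γ∉ = supported T (γ∉ ∘ dual⇒evaluate)

    restriction-transfer : ∀ e → Pr restriction (e ∘ evaluate B) ≈ Pr (distribution T) e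
    restriction-transfer = Pr-reindex (evaluate B) (section ᵀ) retraction restriction (distribution T) (λ _ → refl)
      λ γ γ∉ → supported T (γ∉ ∘ dual⇒evaluate)

    -- The doubled parameters come from λ = 1 - 2 Pr. They enter through inequalities, which leaves
    -- room for the change from 1/n to 1/h.
    spectrum-generator : ∀ {ε δ μ ν} → HasSmoothness T ε → HasSoundness T δ →
      ε + ε ≤ μ → ν ≤ δ + δ → IsSpectrumGenerator restriction B μ ν
    spectrum-generator {ε} {δ} {μ} {ν} smooth sound ε+ε≤μ ν≤δ+δ =
      (λ i → ≤-respʳ (sym (eigenvalue-generator restriction (distribution T) B restriction-transfer i))
        (1-mono-≤ (≤-trans (+-mono-≤ (smooth i) (smooth i)) ε+ε≤μ))) ,
      -- The rank hypothesis already carries a representation `v` of `a`, and soundness is applied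
      -- to this word.
      λ { a r rank@((v , _ , a≗v) , _) →
        let a≗v∙ = λ α → ≡.trans (a≗v α) (apply-linearCombination B v α)
            δr≤P = sound v r (rank⇒distance C B check a v a≗v∙ rank)
        in ≤-respˡ (sym (eigenvalue-combination restriction (distribution T) B restriction-transfer a v a≗v∙))
          (1-mono-≤ (≤-trans (*ι-mono-≤ r ν≤δ+δ)
            (≤-respˡ (sym (distribʳ (ι r) δ δ)) (+-mono-≤ δr≤P δr≤P)))) }

  module _ {h m} (B : Fin m → LinearFunction h) (spans : Spans (Dual h) B) (D : Distribution h) where
    open GeneratorsToCode B spans

    -- The only possible preimage of `γ` under `evaluate B` is `retract γ`; the test decides whether
    -- it is one.
    pushforward-mass : Vec Bool m → Carrier
    pushforward-mass γ = mass D (retract γ) when (evaluate B (retract γ) ≟ γ)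

    pushforward-vanishes : ∀ γ → evaluate B (retract γ) ≢ γ → pushforward-mass γ ≈ 0#
    pushforward-vanishes γ = when-false (evaluate B (retract γ) ≟ γ)

    pushforward-evaluate : ∀ β → mass D β ≈ pushforward-mass (evaluate B β)
    pushforward-evaluate β = sym (trans
      (when-true (evaluate B (retract (evaluate B β)) ≟ evaluate B β) (≡.cong (evaluate B) (retract∘evaluate β)))
      (reflexive (≡.cong (mass D) (retract∘evaluate β))))

    pushforward : Tester C
    pushforward = record
      { distribution = record
        { mass        = pushforward-mass
        ; nonNegative = λ γ → when-nonNegative (evaluate B (retract γ) ≟ γ) (nonNegative D (retract γ))
        ; total       = trans
            (sym (∑-reindex (evaluate B) retract retract∘evaluate pushforward-mass pushforward-vanishes))
            (trans (sym (∑-cong pushforward-evaluate)) (total D))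
        }
      ; supported = λ {γ} γ∉C⊥ → pushforward-vanishes γ λ γ∈ →
          γ∉C⊥ (≡.subst (DualCode C) γ∈ (evaluate∈dual (retract γ)))
      }

    pushforward-transfer : ∀ e → Pr D (e ∘ evaluate B) ≈ Pr (distribution pushforward) e
    pushforward-transfer =
      Pr-reindex (evaluate B) retract retract∘evaluate D (distribution pushforward) pushforward-evaluate pushforward-vanishes

    -- The rejection probability of a word `v` is read off from the eigenvalue of Σ vᵢ bᵢ, whose
    -- rank is the distance of `v`.
    locally-testable : ∀ {μ ν ε δ} → IsSpectrumGenerator D B μ ν →
      μ ≤ ε + ε → δ + δ ≤ ν → HasSmoothness pushforward ε × HasSoundness pushforward δ
    locally-testable {μ} {ν} {ε} {δ} (generators , all) μ≤ε+ε δ+δ≤ν =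
      (λ i → double-cancel-≤ (≤-trans
        (1-cancel-≤ (≤-respʳ (eigenvalue-generator D (distribution pushforward) B pushforward-transfer i) (generators i)))
        μ≤ε+ε)) ,
      λ v d dist →
        let a    = linearCombination (Dual h) B v
            a≗v∙ = apply-linearCombination B v
        in double-cancel-≤ (≤-respˡ (distribʳ (ι d) δ δ) (≤-trans (*ι-mono-≤ d δ+δ≤ν)
          (1-cancel-≤ (≤-respˡ (eigenvalue-combination D (distribution pushforward) B pushforward-transfer a v a≗v∙)
            (all a d (distance⇒rank C B check a v a≗v∙ dist))))))

-- Constants and infinite families

module Families {c ℓ₁ ℓ₂} (ℝ : RealNumbers c ℓ₁ ℓ₂) where
  open OverReals ℝ
  open OrderedField ℝ
  open Transfer ℝ
  open CommutativeSemigroupProperties (CommutativeRing.*-commutativeSemigroup commutativeRing) using (xy∙z≈xz∙y)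

  GoodCode : (κ ρ A a : Carrier) (n : ℕ) .{{_ : NonZero n}} → Set _
  GoodCode κ ρ A a n = Σ[ C ∈ LinearCode n ]
    (∃[ k ] IsDimension C k × κ * ι n ≤ ι k) ×
    (∃[ d ] IsMinimumDistance C d × ρ * ι n ≤ ι d) ×
    IsLocallyTestable C (A / n) (a / n)

  GoodGenerators : (ρ₀ ρ₁ A′ a′ : Carrier) (h : ℕ) .{{_ : NonZero h}} → Set _
  GoodGenerators ρ₀ ρ₁ A′ a′ h = Σ[ D ∈ Distribution h ] Σ[ m ∈ ℕ ] Σ[ B ∈ (Fin m → LinearFunction h) ]
    Injective _≡_ (RawLeftModule._≈ᴹ_ (Dual h)) B ×
    Spans (Dual h) B ×
    IsWiseIndependent (ρ₀ * ι h) B ×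
    ρ₁ * ι h ≤ ι m ×
    IsSpectrumGenerator D B (A′ / h) (a′ / h)

  0<x+x : ∀ {x} → 0# < x → 0# < x + x
  0<x+x 0<x = <-respˡ (+-identityˡ 0#) (+-mono-< 0<x 0<x)

  /-*ι-* : ∀ x K h .{{_ : NonZero h}} → x / h * ι (K ℕ.* h) ≈ x * ι K
  /-*ι-* x K h = trans
    (*-congˡ (trans (ι-homo-* K h) (*-comm (ι K) (ι h))))
    (trans (sym (*-assoc (x / h) (ι h) (ι K))) (*-congʳ (/-*ι x h)))

  -- n ≤ ρ R n ≤ R d, the integer `R` playing the part of 1/ρ.
  length≤R*distance : ∀ {ρ} R → 1# < ρ * ι R → ∀ {n d} → ρ * ι n ≤ ι d → n ℕ.≤ R ℕ.* d
  length≤R*distance {ρ} R 1<ρR {n} {d} ρn≤d = ι-cancel-≤ (≤-trans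
    (≤-respˡ (*-identityˡ (ι n)) (*ι-mono-≤ n (<⇒≤ 1<ρR)))
    (≤-respˡ (xy∙z≈xz∙y ρ (ι n) (ι R))
      (≤-respʳ (trans (*-comm (ι d) (ι R)) (sym (ι-homo-* R d))) (*ι-mono-≤ R ρn≤d))))

  -- Since h ≤ n, the constant `ρ` survives, the rate is (1 + κ) h ≤ h + k = n, and 2A/n ≤ 2A/h.
  -- Soundness loses the factor 2R because n ≤ 2R h. The threshold on `n` forces d ≥ 3 + N, hence
  -- distinct columns and h ≥ 2 + N.
  code⇒generators : ∀ {κ ρ A a} → 0# < κ → 0# < ρ → 0# < A → 0# < a →
    ∀ R .{{_ : NonZero R}} .{{_ : NonZero (2 ℕ.* R)}} → 1# < ρ * ι R →
    ∀ N n .{{_ : NonZero n}} → R ℕ.* (3 ℕ.+ N) ℕ.≤ n → GoodCode κ ρ A a n →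
    ∃[ h ] N ℕ.≤ h × Σ[ h≢0 ∈ NonZero h ]
      GoodGenerators ρ (1# + κ) (A + A) ((a + a) / (2 ℕ.* R)) h {{h≢0}}
  code⇒generators {κ} {ρ} {A} {a} 0<κ 0<ρ 0<A 0<a R 1<ρR N n n-large
    (C , (k , (b , isBasis) , κn≤k) , (d , d-min , ρn≤d) , T , smooth , sound) =
    codim , ℕ.m+n≤o⇒n≤o 2 2+N≤h , h≢0 , restriction C b isBasis T , n , B ,
    distinct d-min (ℕ.m+n≤o⇒m≤o 3 3+N≤d) ,
    spans ,
    (λ S ∣S∣<ρh → independent d-min
      (ι-cancel-< (<-≤-trans ∣S∣<ρh (≤-trans (*-monoʳ-≤ 0<ρ (ι-mono-≤ h≤n)) ρn≤d)))) ,
    rate ,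
    spectrum-generator C b isBasis T smooth sound
      (≤-respˡ (/-distrib-+ A A n) (/-antimono (0<x+x 0<A) h≤n))
      (≤-respʳ (/-distrib-+ a a n)
        (≤-/ (/-positive codim (/-positive K (0<x+x 0<a)))
          (trans (/-*ι-* ((a + a) / K) K codim) (/-*ι (a + a) K)) n≤Kh))
    where
    open CodeToGenerators C b isBasis

    K = 2 ℕ.* R

    3+N≤d : 3 ℕ.+ N ℕ.≤ d
    3+N≤d = ℕ.*-cancelˡ-≤ R (ℕ.≤-trans n-large (length≤R*distance R 1<ρR ρn≤d))

    2+N≤h : 2 ℕ.+ N ℕ.≤ codim
    2+N≤h = ℕ.s≤s⁻¹ (ℕ.≤-trans 3+N≤d (d≤1+codim d-min))

    1≤h : 1 ℕ.≤ codim
    1≤h = ℕ.m+n≤o⇒m≤o 1 2+N≤h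

    instance
      h≢0 : NonZero codim
      h≢0 = ℕ.>-nonZero 1≤h

    h≤n : codim ℕ.≤ n
    h≤n = ≡.subst (codim ℕ.≤_) (≡.sym dimension) (ℕ.m≤n+m codim k)

    n≤Kh : n ℕ.≤ K ℕ.* codim
    n≤Kh = begin
      n                        ≤⟨ length≤R*distance R 1<ρR ρn≤d ⟩
      -- d ≤ h + 1 ≤ 2h absorbs the off-by-one of the Singleton bound; this is the 2 in `K`.
      R ℕ.* d                  ≤⟨ ℕ.*-monoʳ-≤ R (ℕ.≤-trans (d≤1+codim d-min) (ℕ.+-monoˡ-≤ codim 1≤h)) ⟩
      R ℕ.* (codim ℕ.+ codim)  ≡⟨ regroup R codim ⟩
      K ℕ.* codim              ∎
      where
      open ℕ.≤-Reasoning

      regroup : ∀ r h → r ℕ.* (h ℕ.+ h) ≡ 2 ℕ.* r ℕ.* h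
      regroup = solve-∀

    rate : (1# + κ) * ι codim ≤ ι n
    rate = ≤-respˡ (sym (trans (distribʳ (ι codim) 1# κ) (+-congʳ (*-identityˡ (ι codim)))))
      (≤-respʳ
        (trans (+-comm (ι codim) (ι k)) (trans (sym (ι-homo-+ k codim)) (reflexive (≡.cong ι (≡.sym dimension)))))
        (+-mono-≤ (≤-reflexive refl) (≤-trans (*-monoʳ-≤ 0<κ (ι-mono-≤ h≤n)) κn≤k)))

  -- w ≤ h/R < ρ h. This turns the real bound on independence into the integer condition used by the
  -- packing argument; `h` nonzero makes it strict.
  light : ∀ {ρ} R .{{_ : NonZero R}} → 1# < ρ * ι R →
    ∀ w {h} .{{_ : NonZero h}} → w ℕ.* R ℕ.≤ h → ι w < ρ * ι h
  light {ρ} R 1<ρR w {h} wR≤h = *-cancelʳ-< (0<ι R) (≤-<-trans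
    (≤-respˡ (ι-homo-* w R) (ι-mono-≤ wR≤h))
    (<-respˡ (*-identityˡ (ι h)) (<-respʳ (xy∙z≈xz∙y ρ (ι R) (ι h)) (*-monoˡ-< (0<ι h) 1<ρR))))

  -- With m ≤ K h, dimension m - h ≥ (ρ₁ - 1) h and distance at least ρ₀ h lose a factor `K` when
  -- measured in m, and so does smoothness. Soundness loses only the 2 of λ = 1 - 2 Pr, because h <
  -- m. The summand 2R in the threshold is for packing.
  generators⇒code : ∀ {ρ₀ ρ₁ A′ a′} → 0# < ρ₀ → 1# < ρ₁ → 0# < A′ → 0# < a′ →
    ∀ R .{{_ : NonZero R}} → 1# < ρ₀ * ι R →
    ∀ K .{{_ : NonZero K}} → K ≡ 2 ℕ.^ (4 ℕ.* R) →
    ∀ N h .{{_ : NonZero h}} → N ℕ.+ 2 ℕ.* R ℕ.≤ h → GoodGenerators ρ₀ ρ₁ A′ a′ h →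
    ∃[ m ] N ℕ.≤ m × Σ[ m≢0 ∈ NonZero m ]
      GoodCode ((ρ₁ - 1#) / K) (ρ₀ / K) (A′ / 2 * ι K) (a′ / 2) m {{m≢0}}
  generators⇒code {ρ₀} {ρ₁} {A′} {a′} 0<ρ₀ 1<ρ₁ 0<A′ 0<a′ R 1<ρ₀R K K≡ N h h-large
    (D , m , B , _ , spans , wise , ρ₁h≤m , spectrum) =
    m , ℕ.≤-trans (ℕ.m+n≤o⇒m≤o N h-large) (ℕ.<⇒≤ h<m) , m≢0 , C ,
    (codim , (basis , isBasis) , rate) ,
    distance ,
    pushforward B spans D , locally-testable B spans D spectrum
      (≤-respˡ (halves A′) (+-mono-≤ smoothness smoothness))
      (≤-respʳ (halves a′) (+-mono-≤ soundness soundness))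
    where
    open GeneratorsToCode B spans

    h<m : h ℕ.< m
    h<m = ι-cancel-< (<-≤-trans (<-respˡ (*-identityˡ (ι h)) (*-monoˡ-< (0<ι h) 1<ρ₁)) ρ₁h≤m)

    instance
      m≢0 : NonZero m
      m≢0 = ℕ.>-nonZero (ℕ.≤-<-trans z≤n h<m)

    relation : ∀ c → Codeword C c → ∀ α → apply (linearCombination (Dual h) B c) α ≡ false
    relation c c∈C α = ≡.trans (apply-linearCombination B c α) (Equivalence.to (check c) c∈C α)

    m≤Kh : m ℕ.≤ K ℕ.* h
    m≤Kh = ≡.subst (λ K → m ℕ.≤ K ℕ.* h) (≡.sym K≡) (linear-length-bound syndrome-additive R
      -- The codeword serves both as the set of indices and as the coefficient vector supported on
      -- it.
      (λ c ∣c∣R≤h c∈C → wise c (light R 1<ρ₀R ∣ c ∣ ∣c∣R≤h) c id (relation c c∈C))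
      (ℕ.m+n≤o⇒n≤o N h-large))

    /K*m≤*h : ∀ {x} → 0# < x → x / K * ι m ≤ x * ι h
    /K*m≤*h {x} 0<x = ≤-respʳ
      (trans (*-congˡ (ι-homo-* K h)) (trans (sym (*-assoc (x / K) (ι K) (ι h))) (*-congʳ (/-*ι x K))))
      (*-monoʳ-≤ (/-positive K 0<x) (ι-mono-≤ m≤Kh))

    rate : (ρ₁ - 1#) / K * ι m ≤ ι codim
    rate = ≤-trans (/K*m≤*h (x<y⇒0<y-x 1<ρ₁)) (+-cancelʳ-≤ (≤-respˡ (sym split-h) (≤-respʳ split-m ρ₁h≤m)))
      where
      split-h : (ρ₁ - 1#) * ι h + ι h ≈ ρ₁ * ι h
      split-h = trans (+-congˡ (sym (*-identityˡ (ι h))))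
        (trans (sym (distribʳ (ι h) (ρ₁ - 1#) 1#)) (*-congʳ ([x-y]+y≈x ρ₁ 1#)))

      split-m : ι m ≈ ι codim + ι h
      split-m = trans (reflexive (≡.cong ι dimension)) (trans (ι-homo-+ h codim) (+-comm (ι h) (ι codim)))

    distance : ∃[ d ] IsMinimumDistance C d × ρ₀ / K * ι m ≤ ι d
    distance =
      let (c₀ , c₀∈C , c₀≢⊥)           = nonzero-codeword h<m
          (c , c∈C , c≢⊥ , c-minimal)  = minimum-distance C c₀ c₀∈C c₀≢⊥
      in ∣ c ∣ , c-minimal , ≤-trans (/K*m≤*h 0<ρ₀)
           -- As `≤` is a negation, it suffices to refute a lighter nonzero codeword: it would be a
           -- dependency that independence forbids.
           λ ∣c∣<ρ₀h → c≢⊥ (wise c ∣c∣<ρ₀h c id (relation c c∈C))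

    halves : ∀ x → x / 2 / h + x / 2 / h ≈ x / h
    halves x = trans (sym (/-distrib-+ (x / 2) (x / 2) h)) (/-congˡ h (half+half x))

    smoothness : A′ / 2 / h ≤ A′ / 2 * ι K / m
    smoothness = ≤-/ (/-positive h (/-positive 2 0<A′)) (/-*ι-* (A′ / 2) K h) m≤Kh

    soundness : a′ / 2 / m ≤ a′ / 2 / h
    soundness = /-antimono (/-positive 2 0<a′) (ℕ.<⇒≤ h<m)

corollary16 : ∀ {c ℓ₁ ℓ₂} (ℝ : RealNumbers c ℓ₁ ℓ₂) → let open OverReals ℝ in
    (∃[ κ ] ∃[ ρ ] ∃[ A ] ∃[ a ]
    0# < κ × 0# < ρ × 0# < A × 0# < a ×
    InfinitelyMany λ n →
    Σ[ C ∈ LinearCode n ]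
    (∃[ k ] IsDimension C k × κ * ι n ≤ ι k) ×
    (∃[ d ] IsMinimumDistance C d × ρ * ι n ≤ ι d) ×
    IsLocallyTestable C (A / n) (a / n))
    ⇔
    (∃[ ρ₀ ] ∃[ ρ₁ ] ∃[ A′ ] ∃[ a′ ]
    0# < ρ₀ × 1# < ρ₁ × 0# < A′ × 0# < a′ ×
    InfinitelyMany λ h →
    Σ[ D ∈ Distribution h ] Σ[ m ∈ ℕ ] Σ[ B ∈ (Fin m → LinearFunction h) ]
    Injective _≡_ (RawLeftModule._≈ᴹ_ (Dual h)) B ×
    Spans (Dual h) B ×
    IsWiseIndependent (ρ₀ * ι h) B ×
    ρ₁ * ι h ≤ ι m ×
    IsSpectrumGenerator D B (A′ / h) (a′ / h))
corollary16 ℝ = mk⇔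
  (λ { (κ , ρ , A , a , 0<κ , 0<ρ , 0<A , 0<a , codes) →
    let (R , R≢0 , 1<ρR) = archimedean-* 0<ρ
        2R≢0             = ℕ.m*n≢0 2 R {{_}} {{R≢0}}
    in ρ , 1# + κ , A + A , (_/_ (a + a) (2 ℕ.* R) {{2R≢0}}) ,
       0<ρ , <-respˡ (+-identityʳ 1#) (+-monoʳ-< 1# 0<κ) , 0<x+x 0<A ,
       /-positive (2 ℕ.* R) {{2R≢0}} (0<x+x 0<a) ,
       λ N → let (n , n-large , n≢0 , code) = codes (R ℕ.* (3 ℕ.+ N))
             in code⇒generators 0<κ 0<ρ 0<A 0<a R {{R≢0}} {{2R≢0}} 1<ρR N n {{n≢0}} n-large code })
  (λ { (ρ₀ , ρ₁ , A′ , a′ , 0<ρ₀ , 1<ρ₁ , 0<A′ , 0<a′ , generators) →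
    let (R , R≢0 , 1<ρ₀R) = archimedean-* 0<ρ₀
        K                 = 2 ℕ.^ (4 ℕ.* R)
        K≢0               = ℕ.m^n≢0 2 (4 ℕ.* R)
    in (_/_ (ρ₁ - 1#) K {{K≢0}}) , (_/_ ρ₀ K {{K≢0}}) , A′ / 2 * ι K , a′ / 2 ,
       /-positive K {{K≢0}} (x<y⇒0<y-x 1<ρ₁) , /-positive K {{K≢0}} 0<ρ₀ ,
       *-positive (/-positive 2 0<A′) (0<ι K {{K≢0}}) , /-positive 2 0<a′ ,
       λ N → let (h , h-large , h≢0 , gens) = generators (N ℕ.+ 2 ℕ.* R)
             in generators⇒code 0<ρ₀ 1<ρ₁ 0<A′ 0<a′ R {{R≢0}} 1<ρ₀R K {{K≢0}} ≡.refl N h {{h≢0}} h-large gens })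
  where
  open OverReals ℝ
  open OrderedField ℝ
  open Families ℝ
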